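{- There exist constants $\delta,\gamma>0$ such that for every large enough $n$ there is a triangle-free graph on $n$ vertices with minimum degree at least $\delta\sqrt{n}$ that contains no semi-bipartite induced subgraph of minimum degree at least $\gamma\log n$.
   Context: Given a graph $G=(V,E)$, an induced subgraph $G'=G[V']$ (with $V'\neq\emptyset$) is semi-bipartite if it admits a partition $V'=V_1\cup V_2$ such that $V_1$ is a stable set of $G$. The degree of a vertex of $G'$ with respect to the semi-bipartition is its degree in the bipartite graph $G[V_1,V_2]$ consisting of the edges of $G$ between $V_1$ and $V_2$ (edges inside $V_2$ are ignored), and the minimum degree of the semi-bipartite induced subgraph is the minimum of these degrees over $V'$. Thus the graph contains a semi-bipartite induced subgraph of minimum degree at least $t$ iff there are disjoint $V_1,V_2$, not both empty, with $V_1$ stable, such that every vertex of $V_1\cup V_2$ has at least $t$ neighbours on the other side. $\log$ is the natural logarithm. -}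

module Defs where

open import Data.Nat using (ℕ; zero; suc; _+_)
open import Data.Bool using (Bool; true; false; _∧_; _∨_; if_then_else_)
open import Data.Fin using (Fin; zero; suc)
open import Data.Product using (Σ; ∃; _×_)
open import Data.Empty using (⊥)
open import Relation.Binary.PropositionalEquality using (_≡_)

count : ∀ {n} → (Fin n → Bool) → ℕ
count {zero}  p = 0
count {suc n} p = (if p zero then 1 else 0) + count (λ i → p (suc i))

record Graph (n : ℕ) : Set where
  field
    adj    : Fin n → Fin n → Bool
    sym    : ∀ u v → adj u v ≡ adj v u
    irrefl : ∀ v → adj v v ≡ false
open Graph public

deg : ∀ {n} → Graph n → Fin n → ℕ
deg G v = count (adj G v)

TriangleFree : ∀ {n} → Graph n → Set
TriangleFree G = ∀ u v w → adj G u v ≡ true → adj G v w ≡ true → adj G u w ≡ true → ⊥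

record SemiBipartite {n : ℕ} (G : Graph n) : Set where
  field
    V₁ V₂    : Fin n → Bool
    disjoint : ∀ v → V₁ v ≡ true → V₂ v ≡ false
    nonempty : ∃ λ v → V₁ v ∨ V₂ v ≡ true
    stable   : ∀ u v → V₁ u ≡ true → V₁ v ≡ true → adj G u v ≡ false
open SemiBipartite public

-- Degree of v in the bipartite graph G[V₁,V₂]: number of neighbours on the other side.
sbDeg : ∀ {n} {G : Graph n} → SemiBipartite G → Fin n → ℕ
sbDeg {G = G} S v =
  if V₁ S v then count (λ u → V₂ S u ∧ adj G v u)
  else count (λ u → V₁ S u ∧ adj G v u)

-- every vertex of V₁ ∪ V₂ has semi-bipartite degree satisfying P
-- (i.e. the minimum degree satisfies the upward-closed bound P)
SBMinDeg : ∀ {n} {G : Graph n} → SemiBipartite G → (ℕ → Set) → Set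
SBMinDeg S P = ∀ v → V₁ S v ∨ V₂ S v ≡ true → P (sbDeg S v)

module Submission where

-- Take a random digraph on n vertices in which every arc is present with probability 1/σ, σ ≈ 128√n,
-- forget orientations, and delete the arcs of a greedily chosen maximal family of arc-disjoint triangles.
-- For a set Q of M arcs, few arcs of Q are present with probability 2 ^ -Ω(M/σ), and the same bound holds
-- for the event that many chosen triangles meet Q: the expected value of Σ 2 ^ |F| over disjoint families F
-- of present triangles meeting Q is at most (1 + 2/σ³) ^ (48 n M), which is small because n ≪ σ².
-- So Ω(M/σ) arcs of Q survive. Stars give the minimum degree, and Q = A × A shows that stable sets have
-- size O(σ log n). Finally, if |A| ≤ |B| and |A| = O(σ log n), then too few arcs join A and B
-- for every vertex of B to have γ log n neighbours in A. All of this survives a union bound.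
-- Probabilities are sums with natural weights, and every estimate is cleared of denominators.

open import Defs hiding (sym)
open import Data.Nat
open import Data.Nat.Properties
open import Data.Nat.DivMod using (_/_; _%_; m/n*n≤m; m≡m%n+[m/n]*n; m%n<n)
open import Data.Nat.Tactic.RingSolver using (solve-∀)
open import Data.Bool using (Bool; true; false; T; _∧_; _∨_; not; if_then_else_)
open import Data.Bool.Properties using (∨-comm)
open import Data.Fin using (Fin; zero; suc; combine; remQuot; _↑ˡ_; _↑ʳ_) renaming (_≟_ to _≟ᶠ_)
open import Data.Fin.Properties using (combine-injective; remQuot-combine)
open import Data.List using (List; []; _∷_; _++_; concat; tabulate)
open import Data.List.Membership.Propositional using (_∈_)
open import Data.List.Membership.Propositional.Properties using (∈-concat⁺′; ∈-tabulate⁺)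
open import Data.List.Relation.Unary.Any using (here; there)
open import Data.Product using (Σ; ∃; _×_; _,_; proj₁; proj₂; uncurry)
open import Data.Sum using (_⊎_; inj₁; inj₂)
open import Data.Empty using (⊥; ⊥-elim)
open import Data.Vec.Functional using () renaming (_∷_ to _◂_)
open import Function using (_∘_)
open import Relation.Nullary using (¬_; yes; no; does)
open import Relation.Binary.PropositionalEquality
  using (_≡_; _≢_; refl; sym; trans; cong; cong₂; subst; _≗_)
open import Algebra.Properties.Semiring.Sum +-*-semiring
  using (sum; ∑-distrib-+; ∑-comm; sum-cong-≗; *-distribˡ-sum; *-distribʳ-sum)
open import Algebra.Properties.CommutativeMonoid.Sum *-1-commutativeMonoid
  using () renaming (sum to product; sum-cong-≗ to product-cong)
open ≤-Reasoning

-- The number of all triangles meeting `Q` has too heavy an upper tail for a union bound over this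
-- many sets `Q`: a few extra arcs can create many triangles that share arcs. Disjoint triangles
-- avoid this, because k of them are all present with probability σ^(-3k), so the moment of 2^|F| is
-- bounded by a product. Sampling arcs instead of edges makes the probability space a product
-- indexed by `Fin (n * n)`, at the price of constants only. The union bound over vertex sets
-- charges a factor of order n per vertex. For A × A the failure exponent |A|²/σ beats |A| log n
-- once |A| is a large multiple of σ log n. For a pair with |A| ≤ |B| the charge is n^O(|B|), and
-- the expected number of arcs between the two sets is O(|A||B|/σ) = O(|B| log n), so a deviation of
-- order |B| log n pays for it. Deletion can only remove such arcs, so this last event is stated for
-- the sample before deletion.

private variable
  m n : ℕ

-- Sums over subsets and the first moment method

ind : Bool → ℕ
ind b = if b then 1 else 0

ind≤1 : ∀ b → ind b ≤ 1
ind≤1 true  = ≤-refl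
ind≤1 false = z≤n

count≡sum : (p : Fin n → Bool) → count p ≡ sum (ind ∘ p)
count≡sum {zero}  p = refl
count≡sum {suc n} p = cong (ind (p zero) +_) (count≡sum (p ∘ suc))

sum-mono : {f g : Fin n → ℕ} → (∀ i → f i ≤ g i) → sum f ≤ sum g
sum-mono {zero}  f≤g = z≤n
sum-mono {suc n} f≤g = +-mono-≤ (f≤g zero) (sum-mono (f≤g ∘ suc))

sum-const : ∀ n c → sum {n} (λ _ → c) ≡ n * c
sum-const zero    c = refl
sum-const (suc n) c = cong (c +_) (sum-const n c)

term≤sum : (f : Fin n → ℕ) (i : Fin n) → f i ≤ sum f
term≤sum f zero    = m≤m+n _ _
term≤sum f (suc i) = ≤-trans (term≤sum (f ∘ suc) i) (m≤n+m _ _)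

sum-*-sum : (f : Fin m → ℕ) (g : Fin n → ℕ) →
            sum (λ i → sum (λ j → f i * g j)) ≡ sum f * sum g
sum-*-sum f g = trans (sum-cong-≗ (λ i → sym (*-distribˡ-sum (f i) g)))
                      (sym (*-distribʳ-sum (sum g) f))

count-mono : {p q : Fin n → Bool} → (∀ i → ind (p i) ≤ ind (q i)) → count p ≤ count q
count-mono {p = p} {q} h rewrite count≡sum p | count≡sum q = sum-mono h

count-cong : {p q : Fin n → Bool} → p ≗ q → count p ≡ count q
count-cong h = ≤-antisym (count-mono (λ i → ≤-reflexive (cong ind (h i))))
                         (count-mono (λ i → ≤-reflexive (cong ind (sym (h i)))))

product-const : ∀ n c → product {n} (λ _ → c) ≡ c ^ n
product-const zero    c = refl
product-const (suc n) c = cong (c *_) (product-const n c)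

-- The factor `d ^ count Q` replaces the subtraction in c^|Q| d^(m-|Q|).
product-mask : ∀ (Q : Fin m → Bool) c d →
               product (λ i → if Q i then c else d) * d ^ count Q ≡ c ^ count Q * d ^ m
product-mask {zero}  Q c d = refl
product-mask {suc m} Q c d with Q zero | product-mask (Q ∘ suc) c d
... | true  | ih = trans (shuffle c d _ _) (trans (cong (λ z → c * d * z) ih) (sym (shuffle c d _ _)))
  where
  shuffle : ∀ c d p q → c * p * (d * q) ≡ c * d * (p * q)
  shuffle = solve-∀
... | false | ih = trans (*-assoc d _ _) (trans (cong (d *_) ih) (shuffle d (c ^ count (Q ∘ suc)) _))
  where
  shuffle : ∀ d p q → d * (p * q) ≡ p * (d * q)
  shuffle = solve-∀

-- The sum of f over all subsets x of Fin m, a subset with k elements having weight a ^ (m ∸ k) * b ^ k.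
wsum : ℕ → ℕ → ((Fin m → Bool) → ℕ) → ℕ
wsum {zero}  a b f = f λ ()
wsum {suc m} a b f = a * wsum a b (λ x → f (false ◂ x)) + b * wsum a b (λ x → f (true ◂ x))

module _ (a b : ℕ) where

  wsum-mono : {f g : (Fin m → Bool) → ℕ} → (∀ x → f x ≤ g x) → wsum a b f ≤ wsum a b g
  wsum-mono {zero}  h = h _
  wsum-mono {suc m} h = +-mono-≤ (*-monoʳ-≤ a (wsum-mono (λ x → h (false ◂ x))))
                                 (*-monoʳ-≤ b (wsum-mono (λ x → h (true ◂ x))))

  wsum-cong : {f g : (Fin m → Bool) → ℕ} → f ≗ g → wsum a b f ≡ wsum a b g
  wsum-cong h = ≤-antisym (wsum-mono (≤-reflexive ∘ h)) (wsum-mono (≤-reflexive ∘ sym ∘ h))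

  wsum-zero : ∀ m → wsum {m} a b (λ _ → 0) ≡ 0
  wsum-zero zero    = refl
  wsum-zero (suc m) rewrite wsum-zero m | *-zeroʳ a | *-zeroʳ b = refl

  wsum-+ : (f g : (Fin m → Bool) → ℕ) → wsum a b (λ x → f x + g x) ≡ wsum a b f + wsum a b g
  wsum-+ {zero}  f g = refl
  wsum-+ {suc m} f g = trans
    (cong₂ _+_ (cong (a *_) (wsum-+ (λ x → f (false ◂ x)) (λ x → g (false ◂ x))))
               (cong (b *_) (wsum-+ (λ x → f (true ◂ x)) (λ x → g (true ◂ x)))))
    (shuffle a b _ _ _ _)
    where
    shuffle : ∀ a b s t u v → a * (s + t) + b * (u + v) ≡ a * s + b * u + (a * t + b * v)
    shuffle = solve-∀

  wsum-*ˡ : ∀ c (f : (Fin m → Bool) → ℕ) → wsum a b (λ x → c * f x) ≡ c * wsum a b f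
  wsum-*ˡ {zero}  c f = refl
  wsum-*ˡ {suc m} c f = trans
    (cong₂ _+_ (cong (a *_) (wsum-*ˡ c (λ x → f (false ◂ x))))
               (cong (b *_) (wsum-*ˡ c (λ x → f (true ◂ x)))))
    (shuffle a b c _ _)
    where
    shuffle : ∀ a b c s t → a * (c * s) + b * (c * t) ≡ c * (a * s + b * t)
    shuffle = solve-∀

  wsum-*ʳ : ∀ (f : (Fin m → Bool) → ℕ) c → wsum a b (λ x → f x * c) ≡ wsum a b f * c
  wsum-*ʳ f c = trans (wsum-cong (λ x → *-comm (f x) c)) (trans (wsum-*ˡ c f) (*-comm c _))

  wsum-sum : (f : (Fin m → Bool) → Fin n → ℕ) →
             wsum a b (λ x → sum (f x)) ≡ sum (λ i → wsum a b (λ x → f x i))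
  wsum-sum {m} {zero}  f = wsum-zero m
  wsum-sum {m} {suc n} f = trans (wsum-+ (λ x → f x zero) _)
                                 (cong (wsum a b (λ x → f x zero) +_) (wsum-sum (λ x → f x ∘ suc)))

  wsum-comm : ∀ c d (f : (Fin m → Bool) → (Fin n → Bool) → ℕ) →
              wsum a b (λ x → wsum c d (f x)) ≡ wsum c d (λ y → wsum a b (λ x → f x y))
  wsum-comm {m} {zero}  c d f = refl
  wsum-comm {m} {suc n} c d f = trans (wsum-+ {m} (λ x → c * wsum c d (λ y → f x (false ◂ y))) _) (cong₂ _+_
    (trans (wsum-*ˡ {m} c _) (cong (c *_) (wsum-comm c d (λ x y → f x (false ◂ y)))))
    (trans (wsum-*ˡ {m} d _) (cong (d *_) (wsum-comm c d (λ x y → f x (true ◂ y))))))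

  -- Independence of the coordinates. All exponential moments below are evaluated through this
  -- identity.
  wsum-product : (g : Fin m → Bool → ℕ) →
                 wsum a b (λ x → product (λ i → g i (x i))) ≡
                 product (λ i → a * g i false + b * g i true)
  wsum-product {zero}  g = refl
  wsum-product {suc m} g = trans
    (cong₂ _+_ (cong (a *_) (wsum-*ˡ {m} (g zero false) _)) (cong (b *_) (wsum-*ˡ {m} (g zero true) _)))
    (trans (shuffle a b _ _ _) (cong ((a * g zero false + b * g zero true) *_) (wsum-product (g ∘ suc))))
    where
    shuffle : ∀ a b s t u → a * (s * u) + b * (t * u) ≡ (a * s + b * t) * u
    shuffle = solve-∀

-- Pointwise equal to A, but of the form enumerated by wsum.
canon : (Fin n → Bool) → Fin n → Bool
canon {zero}  A = λ ()
canon {suc n} A = A zero ◂ canon (A ∘ suc)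

canon-≗ : (A : Fin n → Bool) → canon A ≗ A
canon-≗ {suc n} A zero    = refl
canon-≗ {suc n} A (suc i) = canon-≗ (A ∘ suc) i

-- With both weights 1 each subset is one summand, so a vanishing sum excludes the bad event for
-- every subset. Since `f` need not respect pointwise equality, only the enumerated copy `canon A`
-- can be reached.
canon≤wsum : (f : (Fin n → Bool) → ℕ) (A : Fin n → Bool) → f (canon A) ≤ wsum 1 1 f
canon≤wsum {zero}  f A = ≤-refl
canon≤wsum {suc n} f A with A zero
... | false = ≤-trans (canon≤wsum (λ x → f (false ◂ x)) (A ∘ suc))
                      (≤-trans (≤-reflexive (sym (*-identityˡ _))) (m≤m+n _ _))
... | true  = ≤-trans (canon≤wsum (λ x → f (true ◂ x)) (A ∘ suc))
                      (≤-trans (≤-reflexive (sym (*-identityˡ _))) (m≤n+m _ (1 * wsum 1 1 (λ x → f (false ◂ x)))))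

-- A mean below 1 forces a zero. The witness is found by conditional expectations: one of the two
-- values of each coordinate keeps the conditional mean below 1.
wsum-small⇒zero : ∀ a b (f : (Fin m → Bool) → ℕ) → wsum a b f < (a + b) ^ m → ∃ λ x → f x ≡ 0
wsum-small⇒zero {zero}  a b f h = (λ ()) , n<1⇒n≡0 h
wsum-small⇒zero {suc m} a b f h with wsum a b (λ x → f (false ◂ x)) <? (a + b) ^ m
... | yes lt = let x , eq = wsum-small⇒zero a b (λ x → f (false ◂ x)) lt in false ◂ x , eq
... | no nlt with wsum a b (λ x → f (true ◂ x)) <? (a + b) ^ m
...   | yes lt = let x , eq = wsum-small⇒zero a b (λ x → f (true ◂ x)) lt in true ◂ x , eq
...   | no nlt′ = ⊥-elim (<⇒≱ h (≤-trans (≤-reflexive (*-distribʳ-+ _ a b))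
                    (+-mono-≤ (*-monoʳ-≤ a (≮⇒≥ nlt)) (*-monoʳ-≤ b (≮⇒≥ nlt′)))))

ind≤ : ℕ → ℕ → ℕ
ind≤ a b = ind (a ≤ᵇ b)

-- Serves both as the pointwise form of Markov's inequality and to restrict a mean estimate to sets
-- of suitable size.
ind≤-guard : ∀ {a b x y} → (a ≤ b → x ≤ y) → ind≤ a b * x ≤ y
ind≤-guard {a} {b} h with a ≤ᵇ b in eq
... | false = z≤n
... | true  = ≤-trans (≤-reflexive (+-identityʳ _)) (h (≤ᵇ⇒≤ a b (subst T (sym eq) _)))

ind≤-yes : ∀ {a b} → a ≤ b → ind≤ a b ≡ 1
ind≤-yes {a} {b} a≤b with a ≤ᵇ b | ≤⇒≤ᵇ a≤b
... | true | _ = refl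

ind≤-zero : ∀ {a b} → ind≤ a b ≡ 0 → b < a
ind≤-zero {a} {b} eq with a ≤? b
... | yes a≤b with () ← trans (sym eq) (ind≤-yes a≤b)
... | no a≰b = ≰⇒> a≰b

-- Exponential estimates

-- The left side consists of the first two terms of the binomial expansion of the right.
bernoulli : ∀ h k → h ^ suc k + suc k * h ^ k ≤ suc h ^ suc k
bernoulli h zero    = ≤-reflexive (lemma h)
  where
  lemma : ∀ h → h * 1 + 1 * 1 ≡ suc h * 1
  lemma = solve-∀
bernoulli h (suc k) = begin
  h * (h * h ^ k) + suc (suc k) * (h * h ^ k)   ≤⟨ m≤m+n _ _ ⟩
  h * (h * h ^ k) + suc (suc k) * (h * h ^ k) + suc k * h ^ k  ≡⟨ lemma h k (h ^ k) ⟩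
  suc h * (h * h ^ k + suc k * h ^ k)           ≤⟨ *-monoʳ-≤ (suc h) (bernoulli h k) ⟩
  suc h ^ suc (suc k)                           ∎
  where
  lemma : ∀ h k y → h * (h * y) + (2 + k) * (h * y) + (1 + k) * y ≡ (1 + h) * (h * y + (1 + k) * y)
  lemma = solve-∀

double-pow : ∀ h → 2 * h ^ suc h ≤ suc h ^ suc h
double-pow h = begin
  2 * (h * h ^ h)            ≤⟨ m≤m+n _ _ ⟩
  2 * (h * h ^ h) + h ^ h    ≡⟨ lemma h (h ^ h) ⟩
  h * h ^ h + suc h * h ^ h  ≤⟨ bernoulli h h ⟩
  suc h ^ suc h              ∎
  where
  lemma : ∀ h y → 2 * (h * y) + y ≡ h * y + (1 + h) * y
  lemma = solve-∀

-- (1 - 1/(h+1)) ^ M ≤ 2 ^ -j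
pow-gap : ∀ h j M → suc h * j ≤ M → 2 ^ j * h ^ M ≤ suc h ^ M
pow-gap h zero    M _ = ≤-trans (≤-reflexive (*-identityˡ _)) (^-monoˡ-≤ M (n≤1+n h))
pow-gap h (suc j) M le with m≤n⇒∃[o]m+o≡n (≤-trans (m≤m+n (suc h) (suc h * j)) (≤-trans (≤-reflexive (sym (*-suc (suc h) j))) le))
... | M′ , refl = begin
  2 * 2 ^ j * h ^ (suc h + M′)            ≡⟨ cong (2 * 2 ^ j *_) (^-distribˡ-+-* h (suc h) M′) ⟩
  2 * 2 ^ j * (h ^ suc h * h ^ M′)        ≡⟨ lemma (2 ^ j) (h ^ suc h) (h ^ M′) ⟩
  (2 * h ^ suc h) * (2 ^ j * h ^ M′)      ≤⟨ *-mono-≤ (double-pow h) (pow-gap h j M′ le′) ⟩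
  suc h ^ suc h * suc h ^ M′              ≡⟨ ^-distribˡ-+-* (suc h) (suc h) M′ ⟨
  suc h ^ (suc h + M′)                    ∎
  where
  le′ : suc h * j ≤ M′
  le′ = +-cancelˡ-≤ (suc h) _ _ (≤-trans (≤-reflexive (sym (*-suc (suc h) j))) le)
  lemma : ∀ a b c → 2 * a * (b * c) ≡ (2 * b) * (a * c)
  lemma = solve-∀

-- In quotients, (1 + z/h)^i ≤ 1 + 2zi/h. The slope 2z in place of z leaves room for the
-- second-order term z(2zi), which the hypothesis bounds by zh.
pow-linear : ∀ h z i → 2 * z * i ≤ h → (h + z) ^ i * h ≤ h ^ i * (h + 2 * z * i)
pow-linear h z zero    _  = ≤-reflexive (cong (1 *_) (sym (trans (cong (h +_) (*-zeroʳ (2 * z))) (+-identityʳ h))))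
pow-linear h z (suc i) le = begin
  (h + z) * (h + z) ^ i * h                 ≡⟨ *-assoc (h + z) _ _ ⟩
  (h + z) * ((h + z) ^ i * h)               ≤⟨ *-monoʳ-≤ (h + z) (pow-linear h z i le′) ⟩
  (h + z) * (h ^ i * (h + 2 * z * i))       ≡⟨ expand h z i (h ^ i) ⟩
  h ^ i * (h * (h + z + 2 * z * i) + z * (2 * z * i))
    ≤⟨ *-monoʳ-≤ (h ^ i) (+-monoʳ-≤ (h * (h + z + 2 * z * i)) (*-monoʳ-≤ z le′)) ⟩
  h ^ i * (h * (h + z + 2 * z * i) + z * h) ≡⟨ collect h z i (h ^ i) ⟩
  h * h ^ i * (h + 2 * z * suc i)           ∎
  where
  le′ : 2 * z * i ≤ h
  le′ = ≤-trans (*-monoʳ-≤ (2 * z) (n≤1+n i)) le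
  expand : ∀ h z i y → (h + z) * (y * (h + 2 * z * i)) ≡ y * (h * (h + z + 2 * z * i) + z * (2 * z * i))
  expand = solve-∀
  collect : ∀ h z i y → y * (h * (h + z + 2 * z * i) + z * h) ≡ h * y * (h + 2 * z * (1 + i))
  collect = solve-∀

pow-double : ∀ h z i .{{_ : NonZero h}} → 2 * z * i ≤ h → (h + z) ^ i ≤ 2 * h ^ i
pow-double h z i le = *-cancelʳ-≤ _ _ h (begin
  (h + z) ^ i * h          ≤⟨ pow-linear h z i le ⟩
  h ^ i * (h + 2 * z * i)  ≤⟨ *-monoʳ-≤ (h ^ i) (+-monoʳ-≤ h le) ⟩
  h ^ i * (h + h)          ≡⟨ lemma (h ^ i) h ⟩
  2 * h ^ i * h            ∎)
  where
  lemma : ∀ y h → y * (h + h) ≡ 2 * y * h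
  lemma = solve-∀

-- (1 + z/h) ^ N ≤ 2 ^ j
pow-growth : ∀ h z u j N .{{_ : NonZero h}} → 2 * z * u ≤ h → N ≤ u * j → (h + z) ^ N ≤ 2 ^ j * h ^ N
pow-growth h z u zero    N _  le with refl ← n≤0⇒n≡0 (≤-trans le (≤-reflexive (*-zeroʳ u))) = ≤-refl
pow-growth h z u (suc j) N hu le with N ≤? u
... | yes N≤u = begin
  (h + z) ^ N              ≤⟨ pow-double h z N (≤-trans (*-monoʳ-≤ (2 * z) N≤u) hu) ⟩
  2 * h ^ N                ≤⟨ *-monoˡ-≤ (h ^ N) (*-monoʳ-≤ 2 (m^n>0 2 j)) ⟩
  2 * 2 ^ j * h ^ N        ∎
... | no N≰u with m≤n⇒∃[o]m+o≡n (<⇒≤ (≰⇒> N≰u))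
...   | N′ , refl = begin
  (h + z) ^ (u + N′)                ≡⟨ ^-distribˡ-+-* (h + z) u N′ ⟩
  (h + z) ^ u * (h + z) ^ N′        ≤⟨ *-mono-≤ (pow-double h z u hu) (pow-growth h z u j N′ hu le′) ⟩
  2 * h ^ u * (2 ^ j * h ^ N′)      ≡⟨ lemma (h ^ u) (2 ^ j) (h ^ N′) ⟩
  2 * 2 ^ j * (h ^ u * h ^ N′)      ≡⟨ cong (2 * 2 ^ j *_) (^-distribˡ-+-* h u N′) ⟨
  2 * 2 ^ j * h ^ (u + N′)          ∎
  where
  le′ : N′ ≤ u * j
  le′ = +-cancelˡ-≤ u _ _ (≤-trans le (≤-reflexive (*-suc u j)))
  lemma : ∀ a b c → 2 * a * (b * c) ≡ 2 * b * (a * c)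
  lemma = solve-∀

-- A union bound over subsets of all sizes without binomial coefficients: the sum of K^(-|A|) over
-- all A is (1 + 1/K)^n, at most 2 because K ≥ 2n. Below, `weight A` is K^(n-|A|).
wsum-subsets : ∀ (f : (Fin n → Bool) → ℕ) K c .{{_ : NonZero K}} → 2 * n ≤ K →
               (∀ A → f A * K ^ count A ≤ c) → wsum 1 1 f ≤ 2 * c
wsum-subsets {n} f K c 2n≤K h = *-cancelʳ-≤ _ _ (K ^ n) {{m^n≢0 K n}} (begin
  wsum 1 1 f * K ^ n                 ≡⟨ wsum-*ʳ 1 1 f (K ^ n) ⟨
  wsum 1 1 (λ A → f A * K ^ n)       ≤⟨ wsum-mono 1 1 step ⟩
  wsum 1 1 (λ A → c * weight A)      ≡⟨ wsum-*ˡ 1 1 c weight ⟩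
  c * wsum 1 1 weight                ≡⟨ cong (c *_) (wsum-product 1 1 {n} (λ _ b → if b then 1 else K)) ⟩
  c * product {n} (λ _ → 1 * K + 1)  ≡⟨ cong (c *_) (product-const n _) ⟩
  c * (1 * K + 1) ^ n                ≡⟨ cong (λ k → c * (k + 1) ^ n) (*-identityˡ K) ⟩
  c * (K + 1) ^ n                    ≤⟨ *-monoʳ-≤ c (pow-double K 1 n 2n≤K) ⟩
  c * (2 * K ^ n)                    ≡⟨ lemma c (K ^ n) ⟩
  2 * c * K ^ n                      ∎)
  where
  lemma : ∀ c y → c * (2 * y) ≡ 2 * c * y
  lemma = solve-∀
  weight : (Fin n → Bool) → ℕ
  weight A = product (λ i → if A i then 1 else K)
  step : ∀ A → f A * K ^ n ≤ c * weight A
  step A = begin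
    f A * K ^ n                     ≡⟨ cong (f A *_) (trans (sym (*-identityˡ _)) (cong (_* K ^ n) (sym (^-zeroˡ (count A))))) ⟩
    f A * (1 ^ count A * K ^ n)     ≡⟨ cong (f A *_) (product-mask A 1 K) ⟨
    f A * (weight A * K ^ count A)  ≡⟨ rearrange (f A) _ _ ⟩
    f A * K ^ count A * weight A    ≤⟨ *-monoˡ-≤ _ (h A) ⟩
    c * weight A                    ∎
    where
    rearrange : ∀ a p k → a * (p * k) ≡ a * k * p
    rearrange = solve-∀

-- Tail bounds for a random subset

*-^-distrib : ∀ a b k → (a * b) ^ k ≡ a ^ k * b ^ k
*-^-distrib a b zero    = refl
*-^-distrib a b (suc k) = trans (cong (a * b *_) (*-^-distrib a b k)) (lemma a b _ _)
  where
  lemma : ∀ a b s t → a * b * (s * t) ≡ a * s * (b * t)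
  lemma = solve-∀

edges : (Fin m → Bool) → (Fin m → Bool) → ℕ
edges Q x = count (λ i → Q i ∧ x i)

pow-edges : (Q x : Fin m → Bool) → 2 ^ edges Q x ≡ product (λ i → if Q i ∧ x i then 2 else 1)
pow-edges {zero}  Q x = refl
pow-edges {suc m} Q x with Q zero ∧ x zero
... | true  = cong (2 *_) (pow-edges (Q ∘ suc) (x ∘ suc))
... | false = trans (pow-edges (Q ∘ suc) (x ∘ suc)) (sym (*-identityˡ _))

-- A lower tail calls for the moment of 2^(-|Q ∩ x|). Giving weight 2 to each element of Q that x
-- misses yields this quantity times 2^|Q|, which is a natural number and still a product over
-- coordinates.
missWeight : Bool → Bool → ℕ
missWeight q b = if q then (if b then 1 else 2) else 1

pow-missed : (Q x : Fin m → Bool) → 2 ^ edges Q x * product (λ i → missWeight (Q i) (x i)) ≡ 2 ^ count Q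
pow-missed {zero}  Q x = refl
pow-missed {suc m} Q x with Q zero | x zero | pow-missed (Q ∘ suc) (x ∘ suc)
... | true  | true  | ih = trans (lemma (2 ^ edges (Q ∘ suc) (x ∘ suc)) _) (cong (2 *_) ih)
  where
  lemma : ∀ a p → 2 * a * (1 * p) ≡ 2 * (a * p)
  lemma = solve-∀
... | true  | false | ih = trans (lemma (2 ^ edges (Q ∘ suc) (x ∘ suc)) _) (cong (2 *_) ih)
  where
  lemma : ∀ a p → a * (2 * p) ≡ 2 * (a * p)
  lemma = solve-∀
... | false | _     | ih = trans (cong (2 ^ edges (Q ∘ suc) (x ∘ suc) *_) (*-identityˡ _)) ih

-- Each coordinate is true with probability 1 / suc ρ.
module Tails (ρ : ℕ) where

  σ : ℕ
  σ = suc ρ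

  -- Markov for 2^(-e) with e = |Q ∩ x|: its mean is (1 - 1/(2σ))^|Q|, at most 2^(-j), so e ≤ r has
  -- probability at most 2^(r-j).
  lower-tail : ∀ (Q : Fin m → Bool) r j → 2 * σ * j ≤ count Q →
               wsum ρ 1 (λ x → ind≤ (edges Q x) r) * 2 ^ j ≤ 2 ^ r * σ ^ m
  lower-tail {m} Q r j le = *-cancelʳ-≤ _ _ (2 ^ M * σ ^ M) {{m*n≢0 _ _ {{m^n≢0 2 M}} {{m^n≢0 σ M}}}} (begin
    wsum ρ 1 bad * 2 ^ j * (2 ^ M * σ ^ M)     ≡⟨ rearrange₁ (wsum ρ 1 bad) _ _ _ ⟩
    wsum ρ 1 bad * 2 ^ M * (2 ^ j * σ ^ M)     ≡⟨ cong (_* (2 ^ j * σ ^ M)) (wsum-*ʳ ρ 1 bad (2 ^ M)) ⟨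
    wsum ρ 1 (λ x → bad x * 2 ^ M) * (2 ^ j * σ ^ M)    ≤⟨ *-monoˡ-≤ _ (wsum-mono ρ 1 markov) ⟩
    wsum ρ 1 (λ x → 2 ^ r * missed x) * (2 ^ j * σ ^ M) ≡⟨ cong (_* (2 ^ j * σ ^ M)) (wsum-*ˡ ρ 1 (2 ^ r) missed) ⟩
    2 ^ r * wsum ρ 1 missed * (2 ^ j * σ ^ M)  ≡⟨ rearrange₂ (2 ^ r) _ (2 ^ j) (σ ^ M) ⟩
    2 ^ r * (2 ^ j * (wsum ρ 1 missed * σ ^ M)) ≡⟨ cong (λ p → 2 ^ r * (2 ^ j * p)) mean ⟩
    2 ^ r * (2 ^ j * (h ^ M * σ ^ m))          ≡⟨ cong (2 ^ r *_) (*-assoc (2 ^ j) _ _) ⟨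
    2 ^ r * (2 ^ j * h ^ M * σ ^ m)            ≤⟨ *-monoʳ-≤ (2 ^ r) (*-monoˡ-≤ (σ ^ m) (pow-gap h j M (subst (λ k → k * j ≤ M) (sym 1+h≡2σ) le))) ⟩
    2 ^ r * (suc h ^ M * σ ^ m)                ≡⟨ cong (λ p → 2 ^ r * (p * σ ^ m)) (trans (cong (_^ M) 1+h≡2σ) (*-^-distrib 2 σ M)) ⟩
    2 ^ r * (2 ^ M * σ ^ M * σ ^ m)            ≡⟨ rearrange₃ (2 ^ r) (2 ^ M * σ ^ M) (σ ^ m) ⟩
    2 ^ r * σ ^ m * (2 ^ M * σ ^ M)            ∎)
    where
    M h : ℕ
    M = count Q
    -- This is 2σ - 1, left unsimplified so that `factor true` holds by `refl`.
    h = ρ * 2 + 1 * 1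
    1+h≡2σ : suc h ≡ 2 * σ
    1+h≡2σ = lemma ρ
      where
      lemma : ∀ ρ → 1 + (ρ * 2 + 1 * 1) ≡ 2 * (1 + ρ)
      lemma = solve-∀
    bad missed : (Fin m → Bool) → ℕ
    bad x = ind≤ (edges Q x) r
    missed x = product (λ i → missWeight (Q i) (x i))
    markov : ∀ x → bad x * 2 ^ M ≤ 2 ^ r * missed x
    markov x = ind≤-guard {edges Q x} λ e≤r → ≤-trans (≤-reflexive (sym (pow-missed Q x)))
                                      (*-monoˡ-≤ (missed x) (^-monoʳ-≤ 2 e≤r))
    factor : ∀ q → ρ * missWeight q false + 1 * missWeight q true ≡ (if q then h else σ)
    factor true  = refl
    factor false = lemma ρ
      where
      lemma : ∀ ρ → ρ * 1 + 1 * 1 ≡ 1 + ρ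
      lemma = solve-∀
    mean : wsum ρ 1 missed * σ ^ M ≡ h ^ M * σ ^ m
    mean = trans (cong (_* σ ^ M) (trans (wsum-product ρ 1 (λ i → missWeight (Q i)))
                                         (product-cong (λ i → factor (Q i)))))
                 (product-mask Q h σ)
    rearrange₁ : ∀ a b c d → a * b * (c * d) ≡ a * c * (b * d)
    rearrange₁ = solve-∀
    rearrange₂ : ∀ a b c d → a * b * (c * d) ≡ a * (c * (b * d))
    rearrange₂ = solve-∀
    rearrange₃ : ∀ a b c → a * (b * c) ≡ a * c * b
    rearrange₃ = solve-∀

  -- Markov for 2^|Q ∩ x|, whose mean (1 + 1/σ)^|Q| is at most 2^j: every block of u ≤ σ/2 factors
  -- contributes at most 2.
  upper-tail : ∀ (Q : Fin m → Bool) r u j → 2 * u ≤ σ → count Q ≤ u * j →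
               wsum ρ 1 (λ x → ind≤ r (edges Q x)) * 2 ^ r ≤ 2 ^ j * σ ^ m
  upper-tail {m} Q r u j 2u≤σ M≤uj = *-cancelʳ-≤ _ _ (σ ^ M) {{m^n≢0 σ M}} (begin
    wsum ρ 1 bad * 2 ^ r * σ ^ M             ≡⟨ cong (_* σ ^ M) (wsum-*ʳ ρ 1 bad (2 ^ r)) ⟨
    wsum ρ 1 (λ x → bad x * 2 ^ r) * σ ^ M   ≤⟨ *-monoˡ-≤ _ (wsum-mono ρ 1 markov) ⟩
    wsum ρ 1 hits * σ ^ M                    ≡⟨ mean ⟩
    (σ + 1) ^ M * σ ^ m                      ≤⟨ *-monoˡ-≤ (σ ^ m) (pow-growth σ 1 u j M 2u≤σ M≤uj) ⟩
    2 ^ j * σ ^ M * σ ^ m                    ≡⟨ rearrange (2 ^ j) _ _ ⟩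
    2 ^ j * σ ^ m * σ ^ M                    ∎)
    where
    M : ℕ
    M = count Q
    bad hits : (Fin m → Bool) → ℕ
    bad x = ind≤ r (edges Q x)
    hits x = product (λ i → if Q i ∧ x i then 2 else 1)
    markov : ∀ x → bad x * 2 ^ r ≤ hits x
    markov x = ind≤-guard {r} λ r≤e → ≤-trans (^-monoʳ-≤ 2 r≤e) (≤-reflexive (pow-edges Q x))
    factor : ∀ q → ρ * (if q ∧ false then 2 else 1) + 1 * (if q ∧ true then 2 else 1) ≡ (if q then σ + 1 else σ)
    factor true  = lemma ρ
      where
      lemma : ∀ ρ → ρ * 1 + 1 * 2 ≡ 1 + ρ + 1
      lemma = solve-∀
    factor false = lemma ρ
      where
      lemma : ∀ ρ → ρ * 1 + 1 * 1 ≡ 1 + ρ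
      lemma = solve-∀
    mean : wsum ρ 1 hits * σ ^ M ≡ (σ + 1) ^ M * σ ^ m
    mean = trans (cong (_* σ ^ M) (trans (wsum-product ρ 1 (λ i b → if Q i ∧ b then 2 else 1))
                                         (product-cong (λ i → factor (Q i)))))
                 (product-mask Q (σ + 1) σ)
    rearrange : ∀ a b c → a * b * c ≡ a * c * b
    rearrange = solve-∀

-- Disjoint families of triangles

Subset : ℕ → Set
Subset m = Fin m → Bool

infix 4 _⊆_
_⊆_ : Subset m → Subset m → Set
U ⊆ W = ∀ i → U i ≡ true → W i ≡ true

∨-split : ∀ {a b} → a ∨ b ≡ true → a ≡ true ⊎ b ≡ true
∨-split {true}  _ = inj₁ refl
∨-split {false} h = inj₂ h

∨-introʳ : ∀ a {b} → b ≡ true → a ∨ b ≡ true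
∨-introʳ true  _ = refl
∨-introʳ false h = h

∧-split : ∀ {a b} → a ∧ b ≡ true → a ≡ true × b ≡ true
∧-split {true} h = refl , h

∨-false : ∀ {a b} → a ∨ b ≡ false → a ≡ false × b ≡ false
∨-false {false} h = refl , h

insert : Fin m → Subset m → Subset m
insert e U i = does (i ≟ᶠ e) ∨ U i

insert-self : ∀ (e : Fin m) U → insert e U e ≡ true
insert-self e U with e ≟ᶠ e
... | yes _ = refl
... | no ¬p = ⊥-elim (¬p refl)

insert-split : ∀ (e : Fin m) U i → insert e U i ≡ true → i ≡ e ⊎ U i ≡ true
insert-split e U i h with i ≟ᶠ e
... | yes p = inj₁ p
... | no _  = inj₂ h

insert-≢ : ∀ {e i : Fin m} U → i ≢ e → insert e U i ≡ U i
insert-≢ {e = e} {i} U i≢e with i ≟ᶠ e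
... | yes p = ⊥-elim (i≢e p)
... | no _  = refl

edges-insert : ∀ (Q : Subset m) e U → edges Q (insert e U) ≤ ind (Q e) + edges Q U
edges-insert Q zero U with Q zero
... | true  = +-monoʳ-≤ 1 (m≤n+m _ _)
... | false = ≤-refl
edges-insert Q (suc e) U = ≤-trans
  (+-monoʳ-≤ (ind (Q zero ∧ U zero)) (edges-insert (Q ∘ suc) e (U ∘ suc)))
  (≤-reflexive (lemma (ind (Q zero ∧ U zero)) (ind (Q (suc e))) _))
  where
  lemma : ∀ a b c → a + (b + c) ≡ b + (a + c)
  lemma = solve-∀

-- Any three distinct coordinates; distinctness is what gives probability σ^(-3). Vertices enter
-- only with `triangles`.
record Triangle (m : ℕ) : Set where
  constructor triangle
  field
    e₁ e₂ e₃ : Fin m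
    e₁≢e₂    : e₁ ≢ e₂
    e₁≢e₃    : e₁ ≢ e₃
    e₂≢e₃    : e₂ ≢ e₃
open Triangle

meets inside : Triangle m → Subset m → Bool
meets  t U = U (e₁ t) ∨ U (e₂ t) ∨ U (e₃ t)
inside t U = U (e₁ t) ∧ U (e₂ t) ∧ U (e₃ t)

add : Triangle m → Subset m → Subset m
add t U = insert (e₁ t) (insert (e₂ t) (insert (e₃ t) U))

⊆-add : ∀ (t : Triangle m) U → U ⊆ add t U
⊆-add t U i h = ∨-introʳ (does (i ≟ᶠ e₁ t)) (∨-introʳ (does (i ≟ᶠ e₂ t)) (∨-introʳ (does (i ≟ᶠ e₃ t)) h))

add-split : ∀ (t : Triangle m) U i → add t U i ≡ true → (i ≡ e₁ t ⊎ i ≡ e₂ t ⊎ i ≡ e₃ t) ⊎ U i ≡ true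
add-split t U i h with insert-split (e₁ t) (insert (e₂ t) (insert (e₃ t) U)) i h
... | inj₁ p = inj₁ (inj₁ p)
... | inj₂ h with insert-split (e₂ t) (insert (e₃ t) U) i h
...   | inj₁ p = inj₁ (inj₂ (inj₁ p))
...   | inj₂ h with insert-split (e₃ t) U i h
...     | inj₁ p = inj₁ (inj₂ (inj₂ p))
...     | inj₂ h = inj₂ h

add-least : ∀ (t : Triangle m) {U W} → inside t W ≡ true → U ⊆ W → add t U ⊆ W
add-least t {U} {W} in-t U⊆W i h with ∧-split {W (e₁ t)} in-t | add-split t U i h
... | p , _  | inj₁ (inj₁ refl)        = p
... | _ , qr | inj₁ (inj₂ (inj₁ refl)) = proj₁ (∧-split {W (e₂ t)} qr)
... | _ , qr | inj₁ (inj₂ (inj₂ refl)) = proj₂ (∧-split {W (e₂ t)} qr)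
... | _      | inj₂ h                  = U⊆W i h

inside-add : ∀ (t : Triangle m) U → inside t (add t U) ≡ true
inside-add t U
  rewrite insert-self (e₁ t) (insert (e₂ t) (insert (e₃ t) U))
        | ∨-introʳ (does (e₂ t ≟ᶠ e₁ t)) (insert-self (e₂ t) (insert (e₃ t) U))
        | ∨-introʳ (does (e₃ t ≟ᶠ e₁ t)) (∨-introʳ (does (e₃ t ≟ᶠ e₂ t)) (insert-self (e₃ t) U)) = refl

add-mono : ∀ (t : Triangle m) {U W} → U ⊆ W → add t U ⊆ add t W
add-mono t {U} {W} U⊆W = add-least t {U} {add t W} (inside-add t W) (λ i → ⊆-add t W i ∘ U⊆W i)

meets-mono : ∀ (t : Triangle m) {U W} → U ⊆ W → meets t U ≡ true → meets t W ≡ true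
meets-mono t {U} {W} U⊆W h with ∨-split {U (e₁ t)} h
... | inj₁ p rewrite U⊆W _ p = refl
... | inj₂ h with ∨-split {U (e₂ t)} h
...   | inj₁ p rewrite U⊆W _ p = ∨-introʳ (W (e₁ t)) refl
...   | inj₂ p rewrite U⊆W _ p = ∨-introʳ (W (e₁ t)) (∨-introʳ (W (e₂ t)) refl)

inside⇒meets : ∀ (t : Triangle m) {U} → inside t U ≡ true → meets t U ≡ true
inside⇒meets t {U} h rewrite proj₁ (∧-split {U (e₁ t)} h) = refl

edges-add : ∀ (Q : Subset m) t U → edges Q (add t U) ≤ edges Q U + 3 * ind (meets t Q)
edges-add Q t U = begin
  edges Q (add t U)
    ≤⟨ edges-insert Q (e₁ t) _ ⟩
  a + edges Q (insert (e₂ t) (insert (e₃ t) U))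
    ≤⟨ +-monoʳ-≤ a (edges-insert Q (e₂ t) _) ⟩
  a + (b + edges Q (insert (e₃ t) U))
    ≤⟨ +-monoʳ-≤ a (+-monoʳ-≤ b (edges-insert Q (e₃ t) U)) ⟩
  a + (b + (c + edges Q U))
    ≡⟨ lemma a b c (edges Q U) ⟩
  edges Q U + (a + b + c)
    ≤⟨ +-monoʳ-≤ (edges Q U) (bound (Q (e₁ t)) (Q (e₂ t)) (Q (e₃ t))) ⟩
  edges Q U + 3 * ind (meets t Q) ∎
  where
  a b c : ℕ
  a = ind (Q (e₁ t))
  b = ind (Q (e₂ t))
  c = ind (Q (e₃ t))
  lemma : ∀ a b c d → a + (b + (c + d)) ≡ d + (a + b + c)
  lemma = solve-∀
  bound : ∀ p q r → ind p + ind q + ind r ≤ 3 * ind (p ∨ q ∨ r)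
  bound true  q     r = +-mono-≤ (+-monoʳ-≤ 1 (ind≤1 q)) (ind≤1 r)
  bound false true  r = +-mono-≤ (≤-refl {1}) (≤-trans (ind≤1 r) (n≤1+n 1))
  bound false false r = m≤m+n (ind r) _

Triangles : ℕ → Set
Triangles m = List (Triangle m)

relevant : Subset m → Triangles m → ℕ
relevant Q []       = 0
relevant Q (t ∷ ts) = ind (meets t Q) + relevant Q ts

-- The union of U with a maximal family of pairwise disjoint triangles contained in x and disjoint from U.
greedy : Triangles m → Subset m → Subset m → Subset m
greedy []       x U = U
greedy (t ∷ ts) x U = greedy ts x (if inside t x ∧ not (meets t U) then add t U else U)

greedyCount : Subset m → Triangles m → Subset m → Subset m → ℕ
greedyCount Q []       x U = 0
greedyCount Q (t ∷ ts) x U =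
  if inside t x ∧ not (meets t U) then ind (meets t Q) + greedyCount Q ts x (add t U)
                                  else greedyCount Q ts x U

⊆-greedy : ∀ (ts : Triangles m) x U → U ⊆ greedy ts x U
⊆-greedy []       x U i h = h
⊆-greedy (t ∷ ts) x U i h with inside t x ∧ not (meets t U)
... | true  = ⊆-greedy ts x (add t U) i (⊆-add t U i h)
... | false = ⊆-greedy ts x U i h

-- When t is examined, either it already meets the union, which only grows, or it is chosen itself.
greedy-maximal : ∀ {t} {ts : Triangles m} x U → t ∈ ts → inside t x ≡ true → meets t (greedy ts x U) ≡ true
greedy-maximal {t = t} {.t ∷ ts} x U (here refl) h rewrite h with meets t U in eq
... | true  = meets-mono t (⊆-greedy ts x U) eq
... | false = meets-mono t (⊆-greedy ts x (add t U)) (inside⇒meets t {add t U} (inside-add t U))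
greedy-maximal {ts = t′ ∷ ts} x U (there t∈ts) h with inside t′ x ∧ not (meets t′ U)
... | true  = greedy-maximal x (add t′ U) t∈ts h
... | false = greedy-maximal x U t∈ts h

-- A chosen triangle deletes at most three arcs of Q, and none unless it meets Q.
edges-greedy : ∀ (Q : Subset m) ts x U → edges Q (greedy ts x U) ≤ edges Q U + 3 * greedyCount Q ts x U
edges-greedy Q []       x U = m≤m+n _ _
edges-greedy Q (t ∷ ts) x U with inside t x ∧ not (meets t U)
... | false = edges-greedy Q ts x U
... | true  = begin
  edges Q (greedy ts x (add t U))                             ≤⟨ edges-greedy Q ts x (add t U) ⟩
  edges Q (add t U) + 3 * g                                   ≤⟨ +-monoˡ-≤ (3 * g) (edges-add Q t U) ⟩
  edges Q U + 3 * ind (meets t Q) + 3 * g                     ≡⟨ lemma (edges Q U) (ind (meets t Q)) g ⟩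
  edges Q U + 3 * (ind (meets t Q) + g)                       ∎
  where
  g : ℕ
  g = greedyCount Q ts x (add t U)
  lemma : ∀ a b c → a + 3 * b + 3 * c ≡ a + 3 * (b + c)
  lemma = solve-∀

-- Σ 2 ^ |F| over the pairwise disjoint families F of triangles in ts that meet Q,
-- are disjoint from U, and satisfy U ∪ ⋃ F ⊆ x.
families : Subset m → Triangles m → Subset m → Subset m → ℕ
families Q []       U x = product (λ i → if U i then ind (x i) else 1)
families Q (t ∷ ts) U x =
  if meets t Q then families Q ts U x + (if meets t U then 0 else 2 * families Q ts (add t U) x)
               else families Q ts U x

-- The greedy triangles that meet Q form one of the families being summed. The sum tracks only their
-- union W, while the greedy process also avoids chosen triangles that miss Q; hence two sets with W
-- ⊆ U.
families≥greedy : ∀ (Q : Subset m) ts x U W → W ⊆ U → W ⊆ x →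
                  2 ^ greedyCount Q ts x U ≤ families Q ts W x
families≥greedy {m} Q [] x U W W⊆U W⊆x = ≤-reflexive (sym (trans
  (product-cong (λ i → factor (W i) (x i) (W⊆x i))) (trans (product-const m 1) (^-zeroˡ m))))
  where
  factor : ∀ w b → (w ≡ true → b ≡ true) → (if w then ind b else 1) ≡ 1
  factor true  b h rewrite h refl = refl
  factor false b h = refl
families≥greedy Q (t ∷ ts) x U W W⊆U W⊆x with inside t x in in-x | meets t U in meets-U | meets t Q
... | false | _    | true  = ≤-trans (families≥greedy Q ts x U W W⊆U W⊆x) (m≤m+n _ _)
... | false | _    | false = families≥greedy Q ts x U W W⊆U W⊆x
... | true  | true | true  = ≤-trans (families≥greedy Q ts x U W W⊆U W⊆x) (m≤m+n _ _)
... | true  | true | false = families≥greedy Q ts x U W W⊆U W⊆x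
-- A triangle chosen away from Q enlarges U and leaves W as it is.
... | true  | false | false = families≥greedy Q ts x (add t U) W (λ i → ⊆-add t U i ∘ W⊆U i) W⊆x
... | true  | false | true with meets t W in meets-W
...   | true with () ← trans (sym meets-U) (meets-mono t W⊆U meets-W)
...   | false = ≤-trans (*-monoʳ-≤ 2 (families≥greedy Q ts x (add t U) (add t W)
                          (add-mono t W⊆U) (add-least t in-x W⊆x)))
                        (m≤n+m _ (families Q ts W x))

-- The exponential moment of disjoint triangle families

module FamilyMoments (ρ : ℕ) where
  open Tails ρ

  -- The total weight of all samples containing U.
  free : Subset m → ℕ
  free U = product (λ i → if U i then 1 else σ)

  free-insert : ∀ (e : Fin m) U → U e ≡ false → σ * free (insert e U) ≡ free U
  free-insert zero    U h rewrite h = cong (σ *_) (*-identityˡ _)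
  free-insert (suc e) U h = trans (lemma σ (if U zero then 1 else σ) _)
                                  (cong ((if U zero then 1 else σ) *_) (free-insert e (U ∘ suc) h))
    where
    lemma : ∀ a b c → a * (b * c) ≡ b * (a * c)
    lemma = solve-∀

  free-add : ∀ (t : Triangle m) U → meets t U ≡ false → σ ^ 3 * free (add t U) ≡ free U
  free-add t U h with ∨-false {U (e₁ t)} h
  ... | h₁ , h′ with ∨-false {U (e₂ t)} h′
  ...   | h₂ , h₃ = begin-equality
    σ ^ 3 * free (add t U)                                ≡⟨ lemma σ _ ⟩
    σ * (σ * (σ * free (add t U)))                        ≡⟨ cong (λ k → σ * (σ * k)) (free-insert (e₁ t) _
                                                               (trans (insert-≢ (insert (e₃ t) U) (e₁≢e₂ t)) (trans (insert-≢ U (e₁≢e₃ t)) h₁))) ⟩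
    σ * (σ * free (insert (e₂ t) (insert (e₃ t) U)))      ≡⟨ cong (σ *_) (free-insert (e₂ t) _ (trans (insert-≢ U (e₂≢e₃ t)) h₂)) ⟩
    σ * free (insert (e₃ t) U)                            ≡⟨ free-insert (e₃ t) U h₃ ⟩
    free U                                                ∎
    where
    lemma : ∀ s a → s * (s * (s * 1)) * a ≡ s * (s * (s * a))
    lemma = solve-∀

  -- Each relevant triangle contributes a factor 1 + 2/σ³: it is either left out, or put into F with
  -- weight 2 while its three arcs, being outside U, cost σ^(-3) independently of what is already
  -- required. A triangle meeting U can only be left out.
  families-mean : ∀ (Q : Subset m) ts U →
                  wsum ρ 1 (families Q ts U) * (σ ^ 3) ^ relevant Q ts ≤ free U * (σ ^ 3 + 2) ^ relevant Q ts
  families-mean Q [] U = ≤-reflexive (cong (_* 1) (trans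
    (wsum-product ρ 1 (λ i b → if U i then ind b else 1)) (product-cong (λ i → factor (U i)))))
    where
    factor : ∀ u → ρ * (if u then 0 else 1) + 1 * (if u then 1 else 1) ≡ (if u then 1 else σ)
    factor true  = lemma ρ
      where
      lemma : ∀ ρ → ρ * 0 + 1 * 1 ≡ 1
      lemma = solve-∀
    factor false = lemma ρ
      where
      lemma : ∀ ρ → ρ * 1 + 1 * 1 ≡ 1 + ρ
      lemma = solve-∀
  families-mean Q (t ∷ ts) U with meets t Q
  ... | false = families-mean Q ts U
  ... | true with meets t U in eq
  ...   | true = begin
    wsum ρ 1 (λ x → families Q ts U x + 0) * (s * s ^ N)  ≡⟨ cong (_* (s * s ^ N)) (wsum-cong ρ 1 (λ x → +-identityʳ (families Q ts U x))) ⟩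
    v * (s * s ^ N)                                       ≡⟨ lemma v s (s ^ N) ⟩
    s * (v * s ^ N)                                       ≤⟨ *-mono-≤ (m≤m+n s 2) (families-mean Q ts U) ⟩
    (s + 2) * (free U * (s + 2) ^ N)                      ≡⟨ lemma (free U) (s + 2) _ ⟨
    free U * ((s + 2) * (s + 2) ^ N)                      ∎
    where
    s N v : ℕ
    s = σ ^ 3
    N = relevant Q ts
    v = wsum ρ 1 (families Q ts U)
    lemma : ∀ a b c → a * (b * c) ≡ b * (a * c)
    lemma = solve-∀
  ...   | false = begin
    wsum ρ 1 (λ x → families Q ts U x + 2 * families Q ts (add t U) x) * (s * s ^ N)
      ≡⟨ cong (_* (s * s ^ N)) (trans (wsum-+ ρ 1 (families Q ts U) _) (cong (v +_) (wsum-*ˡ ρ 1 2 (families Q ts (add t U))))) ⟩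
    (v + 2 * w) * (s * s ^ N)
      ≡⟨ expand v w s (s ^ N) ⟩
    s * (v * s ^ N) + 2 * s * (w * s ^ N)
      ≤⟨ +-mono-≤ (*-monoʳ-≤ s (families-mean Q ts U)) (*-monoʳ-≤ (2 * s) (families-mean Q ts (add t U))) ⟩
    s * (free U * S) + 2 * s * (free (add t U) * S)
      ≡⟨ regroup s (free U) S (free (add t U)) ⟩
    s * (free U * S) + 2 * ((s * free (add t U)) * S)
      ≡⟨ cong (λ k → s * (free U * S) + 2 * (k * S)) (free-add t U eq) ⟩
    s * (free U * S) + 2 * (free U * S)
      ≡⟨ collect s (free U) S ⟩
    free U * ((s + 2) * S) ∎
    where
    s N v w S : ℕ
    s = σ ^ 3
    N = relevant Q ts
    v = wsum ρ 1 (families Q ts U)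
    w = wsum ρ 1 (families Q ts (add t U))
    S = (s + 2) ^ N
    expand : ∀ v w s y → (v + 2 * w) * (s * y) ≡ s * (v * y) + 2 * s * (w * y)
    expand = solve-∀
    regroup : ∀ s f S g → s * (f * S) + 2 * s * (g * S) ≡ s * (f * S) + 2 * ((s * g) * S)
    regroup = solve-∀
    collect : ∀ s f S → s * (f * S) + 2 * (f * S) ≡ f * ((s + 2) * S)
    collect = solve-∀

-- Triangles of the complete digraph

sum-↑ : ∀ m {n} (f : Fin (m + n) → ℕ) → sum f ≡ sum (λ i → f (i ↑ˡ n)) + sum (λ j → f (m ↑ʳ j))
sum-↑ zero    f = refl
sum-↑ (suc m) f = trans (cong (f zero +_) (sum-↑ m (f ∘ suc))) (sym (+-assoc (f zero) _ _))

sum-combine : ∀ (f : Fin (m * n) → ℕ) → sum f ≡ sum (λ i → sum (λ j → f (combine {m} i j)))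
sum-combine {zero}      f = refl
sum-combine {suc m} {n} f = trans (sum-↑ n f)
  (cong (sum (λ j → f (combine {suc m} zero j)) +_) (sum-combine {m} (λ k → f (n ↑ʳ k))))

relevant-++ : ∀ (Q : Subset m) ts ts′ → relevant Q (ts ++ ts′) ≡ relevant Q ts + relevant Q ts′
relevant-++ Q []       ts′ = refl
relevant-++ Q (t ∷ ts) ts′ = trans (cong (ind (meets t Q) +_) (relevant-++ Q ts ts′)) (sym (+-assoc (ind (meets t Q)) _ _))

relevant-concat : ∀ (Q : Subset m) (f : Fin n → Triangles m) →
                  relevant Q (concat (tabulate f)) ≡ sum (λ i → relevant Q (f i))
relevant-concat {n = zero}  Q f = refl
relevant-concat {n = suc n} Q f = trans (relevant-++ Q (f zero) _)
                                        (cong (relevant Q (f zero) +_) (relevant-concat Q (f ∘ suc)))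

∈-concat-tabulate : ∀ {t : Triangle m} (f : Fin n → Triangles m) i → t ∈ f i → t ∈ concat (tabulate f)
∈-concat-tabulate f i t∈ = ∈-concat⁺′ t∈ (∈-tabulate⁺ i)

ind-meets : ∀ (t : Triangle m) Q → ind (meets t Q) ≤ ind (Q (e₁ t)) + ind (Q (e₂ t)) + ind (Q (e₃ t))
ind-meets t Q = bound (Q (e₁ t)) (Q (e₂ t)) (Q (e₃ t))
  where
  bound : ∀ p q r → ind (p ∨ q ∨ r) ≤ ind p + ind q + ind r
  bound true  q     r = s≤s z≤n
  bound false true  r = s≤s z≤n
  bound false false r = ≤-refl

-- Arcs u → v of the complete digraph on Fin n are encoded as elements of Fin (n * n).
arc : Bool → Fin n → Fin n → Fin (n * n)
arc true  u v = combine u v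
arc false u v = combine v u

arc-injective : ∀ b b′ {u v u′ v′ : Fin n} → arc b u v ≡ arc b′ u′ v′ → (u ≡ u′ × v ≡ v′) ⊎ (u ≡ v′ × v ≡ u′)
arc-injective true  true  {u} {v} {u′} {v′} eq = inj₁ (combine-injective u v u′ v′ eq)
arc-injective true  false {u} {v} {u′} {v′} eq = inj₂ (combine-injective u v v′ u′ eq)
arc-injective false true  {u} {v} {u′} {v′} eq with combine-injective v u u′ v′ eq
... | p , q = inj₂ (q , p)
arc-injective false false {u} {v} {u′} {v′} eq with combine-injective v u v′ u′ eq
... | p , q = inj₁ (q , p)

-- Different sides have different pairs of end vertices, so the three arcs are distinct for every
-- choice of directions.
orient : ∀ {u v w : Fin n} → u ≢ v → u ≢ w → v ≢ w → Bool → Bool → Bool → Triangle (n * n)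
orient {u = u} {v} {w} u≢v u≢w v≢w a b c = triangle (arc a u v) (arc b v w) (arc c u w)
  (λ eq → case₁₂ (arc-injective a b eq)) (λ eq → case₁₃ (arc-injective a c eq)) (λ eq → case₂₃ (arc-injective b c eq))
  where
  case₁₂ : (u ≡ v × v ≡ w) ⊎ (u ≡ w × v ≡ v) → ⊥
  case₁₂ (inj₁ (p , _)) = u≢v p
  case₁₂ (inj₂ (p , _)) = u≢w p
  case₁₃ : (u ≡ u × v ≡ w) ⊎ (u ≡ w × v ≡ u) → ⊥
  case₁₃ (inj₁ (_ , p)) = v≢w p
  case₁₃ (inj₂ (p , _)) = u≢w p
  case₂₃ : (v ≡ u × w ≡ w) ⊎ (v ≡ w × w ≡ u) → ⊥
  case₂₃ (inj₁ (p , _)) = u≢v (sym p)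
  case₂₃ (inj₂ (p , _)) = v≢w p

-- An edge may come from either arc, so a triangle of the undirected graph can arise from any of
-- eight triples of arcs, cyclic or not.
orientations : ∀ {u v w : Fin n} → u ≢ v → u ≢ w → v ≢ w → Triangles (n * n)
orientations {n} {u} {v} {w} p q r =
  o true true true ∷ o true true false ∷ o true false true ∷ o true false false ∷
  o false true true ∷ o false true false ∷ o false false true ∷ o false false false ∷ []
  where
  o : Bool → Bool → Bool → Triangle (n * n)
  o = orient p q r

orient∈orientations : ∀ {u v w : Fin n} (p : u ≢ v) (q : u ≢ w) (r : v ≢ w) a b c →
                      orient p q r a b c ∈ orientations p q r
orient∈orientations p q r true  true  true  = here refl
orient∈orientations p q r true  true  false = there (here refl)
orient∈orientations p q r true  false true  = there (there (here refl))
orient∈orientations p q r true  false false = there (there (there (here refl)))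
orient∈orientations p q r false true  true  = there (there (there (there (here refl))))
orient∈orientations p q r false true  false = there (there (there (there (there (here refl)))))
orient∈orientations p q r false false true  = there (there (there (there (there (there (here refl))))))
orient∈orientations p q r false false false = there (there (there (there (there (there (there (here refl)))))))

trianglesOn : (u v w : Fin n) → Triangles (n * n)
trianglesOn u v w with u ≟ᶠ v | u ≟ᶠ w | v ≟ᶠ w
... | no p | no q | no r = orientations p q r
... | _    | _    | _    = []

-- Ordered triples repeat every triangle. Copies of a chosen triangle are skipped because they meet
-- the union, and the repetition affects only the constant 48 below.
triangles : ∀ n → Triangles (n * n)
triangles n = concat (tabulate λ u → concat (tabulate λ v → concat (tabulate λ w → trianglesOn {n} u v w)))

∈-triangles : ∀ {u v w : Fin n} → u ≢ v → u ≢ w → v ≢ w → ∀ a b c →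
              ∃ λ t → t ∈ triangles n × e₁ t ≡ arc a u v × e₂ t ≡ arc b v w × e₃ t ≡ arc c u w
∈-triangles {n} {u} {v} {w} u≢v u≢w v≢w a b c = let t , t∈ , eqs = here′ in
  t , ∈-concat-tabulate _ u (∈-concat-tabulate _ v (∈-concat-tabulate _ w t∈)) , eqs
  where
  here′ : ∃ λ t → t ∈ trianglesOn u v w × e₁ t ≡ arc a u v × e₂ t ≡ arc b v w × e₃ t ≡ arc c u w
  here′ with u ≟ᶠ v | u ≟ᶠ w | v ≟ᶠ w
  ... | yes p | _     | _     = ⊥-elim (u≢v p)
  ... | no _  | yes p | _     = ⊥-elim (u≢w p)
  ... | no _  | no _  | yes p = ⊥-elim (v≢w p)
  ... | no p  | no q  | no r  = orient p q r a b c , orient∈orientations p q r a b c , refl , refl , refl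

sum-triple : ∀ (D : Fin n → Fin n → ℕ) →
             sum (λ u → sum (λ v → sum (λ w → D u v + D v w + D u w))) ≡ 3 * n * sum (λ u → sum (D u))
sum-triple {n} D = begin-equality
  sum (λ u → sum (λ v → sum (λ w → D u v + D v w + D u w)))
    ≡⟨ sum-cong-≗ {n} (λ u → sum-cong-≗ {n} (λ v → inner u v)) ⟩
  sum (λ u → sum (λ v → n * D u v + R v + R u))
    ≡⟨ sum-cong-≗ {n} (λ u → middle u) ⟩
  sum (λ u → 2 * n * R u + sum R)
    ≡⟨ ∑-distrib-+ {n} (λ u → 2 * n * R u) (λ _ → sum R) ⟩
  sum (λ u → 2 * n * R u) + sum {n} (λ _ → sum R)
    ≡⟨ cong₂ _+_ (sym (*-distribˡ-sum {n} (2 * n) R)) (sum-const n _) ⟩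
  2 * n * sum R + n * sum R
    ≡⟨ lemma n (sum R) ⟩
  3 * n * sum R ∎
  where
  R : Fin n → ℕ
  R u = sum (D u)
  lemma : ∀ n s → 2 * n * s + n * s ≡ 3 * n * s
  lemma = solve-∀
  inner : ∀ u v → sum (λ w → D u v + D v w + D u w) ≡ n * D u v + R v + R u
  inner u v = trans (∑-distrib-+ {n} (λ w → D u v + D v w) (D u))
    (cong (_+ R u) (trans (∑-distrib-+ {n} (λ _ → D u v) (D v)) (cong (_+ R v) (sum-const n _))))
  middle : ∀ u → sum (λ v → n * D u v + R v + R u) ≡ 2 * n * R u + sum R
  middle u = begin-equality
    sum (λ v → n * D u v + R v + R u)
      ≡⟨ ∑-distrib-+ {n} (λ v → n * D u v + R v) (λ _ → R u) ⟩
    sum (λ v → n * D u v + R v) + sum {n} (λ _ → R u)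
      ≡⟨ cong₂ _+_ (∑-distrib-+ {n} (λ v → n * D u v) R) (sum-const n _) ⟩
    sum (λ v → n * D u v) + sum R + n * R u
      ≡⟨ cong (λ k → k + sum R + n * R u) (sym (*-distribˡ-sum {n} n (D u))) ⟩
    n * R u + sum R + n * R u
      ≡⟨ collect n (R u) (sum R) ⟩
    2 * n * R u + sum R ∎
    where
    collect : ∀ n r s → n * r + s + n * r ≡ 2 * n * r + s
    collect = solve-∀

sum-symmetrized : ∀ (q : Fin n → Fin n → ℕ) →
                  sum (λ u → sum (λ v → q u v + q v u)) ≡ 2 * sum (λ u → sum (q u))
sum-symmetrized {n} q = begin-equality
  sum (λ u → sum (λ v → q u v + q v u))
    ≡⟨ sum-cong-≗ {n} (λ u → ∑-distrib-+ {n} (q u) (λ v → q v u)) ⟩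
  sum (λ u → sum (q u) + sum (λ v → q v u))
    ≡⟨ ∑-distrib-+ {n} (λ u → sum (q u)) (λ u → sum (λ v → q v u)) ⟩
  sum (λ u → sum (q u)) + sum (λ u → sum (λ v → q v u))
    ≡⟨ cong (sum (λ u → sum (q u)) +_) (trans (∑-comm {n} {n} (λ u v → q v u)) (sym (+-identityʳ _))) ⟩
  2 * sum (λ u → sum (q u)) ∎

module _ {n : ℕ} (Q : Subset (n * n)) where

  private
    q D : Fin n → Fin n → ℕ
    q u v = ind (Q (combine u v))
    D u v = q u v + q v u

    ind-arc : ∀ b u v → ind (Q (arc b u v)) ≤ D u v
    ind-arc true  u v = m≤m+n _ _
    ind-arc false u v = m≤n+m _ _

    relevant-on : ∀ u v w → relevant Q (trianglesOn u v w) ≤ 8 * (D u v + D v w + D u w)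
    relevant-on u v w with u ≟ᶠ v | u ≟ᶠ w | v ≟ᶠ w
    ... | yes _ | _     | _     = z≤n
    ... | no _  | yes _ | _     = z≤n
    ... | no _  | no _  | yes _ = z≤n
    ... | no p  | no q  | no r  =
      +-mono-≤ (le true true true) (+-mono-≤ (le true true false) (+-mono-≤ (le true false true)
      (+-mono-≤ (le true false false) (+-mono-≤ (le false true true) (+-mono-≤ (le false true false)
      (+-mono-≤ (le false false true) (+-mono-≤ (le false false false) z≤n)))))))
      where
      le : ∀ a b c → ind (meets (orient p q r a b c) Q) ≤ D u v + D v w + D u w
      le a b c = ≤-trans (ind-meets (orient p q r a b c) Q)
                         (+-mono-≤ (+-mono-≤ (ind-arc a u v) (ind-arc b v w)) (ind-arc c u w))

  -- Here 48 = 8 · 3 · 2: eight orientations, three positions for the side in Q with n choices of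
  -- the remaining vertex, and two directions of that side.
  relevant-triangles : relevant Q (triangles n) ≤ 48 * n * count Q
  relevant-triangles = begin
    relevant Q (triangles n)
      ≡⟨ trans (relevant-concat {n = n} Q _) (sum-cong-≗ {n} λ u →
         trans (relevant-concat {n = n} Q _) (sum-cong-≗ {n} λ v → relevant-concat Q (trianglesOn u v))) ⟩
    sum (λ u → sum (λ v → sum (λ w → relevant Q (trianglesOn {n} u v w))))
      ≤⟨ sum-mono {n} (λ u → sum-mono {n} (λ v → sum-mono {n} (relevant-on u v))) ⟩
    sum (λ u → sum (λ v → sum (λ w → 8 * (D u v + D v w + D u w))))
      ≡⟨ trans (sum-cong-≗ {n} λ u → trans (sum-cong-≗ {n} λ v → sym (*-distribˡ-sum {n} 8 _)) (sym (*-distribˡ-sum {n} 8 _)))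
               (sym (*-distribˡ-sum {n} 8 _)) ⟩
    8 * sum (λ u → sum (λ v → sum (λ w → D u v + D v w + D u w)))
      ≡⟨ cong (8 *_) (trans (sum-triple D) (cong (3 * n *_) (sum-symmetrized q))) ⟩
    8 * (3 * n * (2 * sum (λ u → sum (q u))))
      ≡⟨ cong (λ k → 8 * (3 * n * (2 * k))) (trans (count≡sum Q) (sum-combine {n} (ind ∘ Q))) ⟨
    8 * (3 * n * (2 * count Q))
      ≡⟨ lemma n (count Q) ⟩
    48 * n * count Q ∎
    where
    lemma : ∀ n m → 8 * (3 * n * (2 * m)) ≡ 48 * n * m
    lemma = solve-∀

-- Arcs of a given set that survive the deletion

∅ : Subset m
∅ _ = false

edges-∅ : ∀ (Q : Subset m) → edges Q ∅ ≡ 0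
edges-∅ {zero}  Q = refl
edges-∅ {suc m} Q with Q zero
... | true  = edges-∅ (Q ∘ suc)
... | false = edges-∅ (Q ∘ suc)

survivors : ∀ n → Subset (n * n) → Subset (n * n)
survivors n x i = x i ∧ not (greedy (triangles n) x ∅ i)

edges-split : ∀ (Q x y : Subset m) → edges Q x ≤ edges Q (λ i → x i ∧ not (y i)) + edges Q y
edges-split {zero}  Q x y = z≤n
edges-split {suc m} Q x y = ≤-trans (+-mono-≤ (split (Q zero) (x zero) (y zero)) (edges-split (Q ∘ suc) (x ∘ suc) (y ∘ suc)))
  (≤-reflexive (lemma (ind (Q zero ∧ x zero ∧ not (y zero))) (ind (Q zero ∧ y zero)) _ _))
  where
  split : ∀ q a b → ind (q ∧ a) ≤ ind (q ∧ a ∧ not b) + ind (q ∧ b)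
  split false a     b     = z≤n
  split true  false b     = z≤n
  split true  true  true  = ≤-refl
  split true  true  false = ≤-refl
  lemma : ∀ a b c d → a + b + (c + d) ≡ a + c + (b + d)
  lemma = solve-∀

2^-cancel-< : ∀ {a b} → 2 ^ a < 2 ^ b → a < b
2^-cancel-< {a} {b} h with a <? b
... | yes a<b = a<b
... | no a≮b  = ⊥-elim (<⇒≱ h (^-monoʳ-≤ 2 (≮⇒≥ a≮b)))

cancel-2^ : ∀ c d a y → a * 2 ^ (c + d) ≤ 2 ^ c * y → a * 2 ^ d ≤ y
cancel-2^ c d a y h = *-cancelˡ-≤ (2 ^ c) {{m^n≢0 2 c}} (begin
  2 ^ c * (a * 2 ^ d)  ≡⟨ lemma (2 ^ c) a (2 ^ d) ⟩
  a * (2 ^ c * 2 ^ d)  ≡⟨ cong (a *_) (^-distribˡ-+-* 2 c d) ⟨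
  a * 2 ^ (c + d)      ≤⟨ h ⟩
  2 ^ c * y            ∎)
  where
  lemma : ∀ a b c → a * (b * c) ≡ b * (a * c)
  lemma = solve-∀

-- Outside both events more than 7q arcs of Q are present and fewer than 2q chosen triangles meet Q,
-- so more than 7q - 3 · 2q = q arcs survive. The second event bounds the moment, which dominates 2
-- to the number of these triangles and whose mean is under control.
bad : ∀ n → Subset (n * n) → ℕ → Subset (n * n) → ℕ
bad n Q q x = ind≤ (edges Q x) (7 * q) + ind≤ (2 ^ (2 * q)) (families Q (triangles n) ∅ x)

survivors-many : ∀ n (Q : Subset (n * n)) q x → bad n Q q x ≡ 0 → q < edges Q (survivors n x)
survivors-many n Q q x bad≡0 = +-cancelʳ-< (6 * q) q (edges Q (survivors n x)) (begin-strict
  q + 6 * q                                  ≡⟨⟩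
  7 * q                                      <⟨ ind≤-zero {edges Q x} (m+n≡0⇒m≡0 _ bad≡0) ⟩
  edges Q x                                  ≤⟨ edges-split Q x deleted ⟩
  edges Q (survivors n x) + edges Q deleted  ≤⟨ +-monoʳ-≤ (edges Q (survivors n x)) deleted-few ⟩
  edges Q (survivors n x) + 6 * q            ∎)
  where
  deleted : Subset (n * n)
  deleted = greedy (triangles n) x ∅
  g : ℕ
  g = greedyCount Q (triangles n) x ∅
  g<2q : g < 2 * q
  g<2q = 2^-cancel-< (≤-<-trans (families≥greedy Q (triangles n) x ∅ ∅ (λ _ ()) (λ _ ()))
                                (ind≤-zero {2 ^ (2 * q)} (m+n≡0⇒n≡0 (ind≤ (edges Q x) (7 * q)) bad≡0)))
  lemma : ∀ q → 3 * (2 * q) ≡ 6 * q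
  lemma = solve-∀
  deleted-few : edges Q deleted ≤ 6 * q
  deleted-few = begin
    edges Q deleted        ≤⟨ edges-greedy Q (triangles n) x ∅ ⟩
    edges Q ∅ + 3 * g      ≡⟨ cong (_+ 3 * g) (edges-∅ Q) ⟩
    3 * g                  ≤⟨ *-monoʳ-≤ 3 (<⇒≤ g<2q) ⟩
    3 * (2 * q)            ≡⟨ lemma q ⟩
    6 * q                  ∎

module BadEvents (ρ n : ℕ) (12288n≤σ² : 12288 * n ≤ suc ρ * suc ρ) where
  open Tails ρ
  open FamilyMoments ρ

  -- The lower bound on |Q| gives the first event probability at most 2^(7q-16q). The upper bound
  -- gives at most 48n · 64σq = uq relevant triangles; then the moment has mean at most 2^q, and
  -- Markov at 2^(2q) leaves 2^(-q).
  bad-mean : ∀ (Q : Subset (n * n)) q → 32 * σ * q ≤ count Q → count Q ≤ 64 * σ * q →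
             wsum ρ 1 (bad n Q q) * 2 ^ q ≤ 2 * σ ^ (n * n)
  bad-mean Q q lo hi = begin
    wsum ρ 1 (bad n Q q) * 2 ^ q                     ≡⟨ cong (_* 2 ^ q) (wsum-+ ρ 1 few many) ⟩
    (wsum ρ 1 few + wsum ρ 1 many) * 2 ^ q         ≡⟨ *-distribʳ-+ (2 ^ q) (wsum ρ 1 few) _ ⟩
    wsum ρ 1 few * 2 ^ q + wsum ρ 1 many * 2 ^ q   ≤⟨ +-mono-≤ few-mean many-mean ⟩
    σ ^ (n * n) + σ ^ (n * n)                      ≡⟨ cong (σ ^ (n * n) +_) (+-identityʳ _) ⟨
    2 * σ ^ (n * n)                                ∎
    where
    M N : ℕ
    M = count Q
    N = relevant Q (triangles n)
    few many : Subset (n * n) → ℕ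
    few x = ind≤ (edges Q x) (7 * q)
    many x = ind≤ (2 ^ (2 * q)) (families Q (triangles n) ∅ x)

    few-mean : wsum ρ 1 few * 2 ^ q ≤ σ ^ (n * n)
    few-mean = begin
      wsum ρ 1 few * 2 ^ q        ≤⟨ *-monoʳ-≤ (wsum ρ 1 few) (^-monoʳ-≤ 2 (m≤m+n q (8 * q))) ⟩
      wsum ρ 1 few * 2 ^ (9 * q)  ≤⟨ cancel-2^ (7 * q) (9 * q) (wsum ρ 1 few) _
                                       (≤-trans (≤-reflexive (cong (λ e → wsum ρ 1 few * 2 ^ e) (split q)))
                                                (lower-tail Q (7 * q) (16 * q) (≤-trans (≤-reflexive (scale σ q)) lo))) ⟩
      σ ^ (n * n)                 ∎
      where
      split : ∀ q → 7 * q + 9 * q ≡ 16 * q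
      split = solve-∀
      scale : ∀ s q → 2 * s * (16 * q) ≡ 32 * s * q
      scale = solve-∀

    u : ℕ
    u = 3072 * σ * n

    N≤uq : N ≤ u * q
    N≤uq = begin
      N                       ≤⟨ relevant-triangles {n} Q ⟩
      48 * n * M              ≤⟨ *-monoʳ-≤ (48 * n) hi ⟩
      48 * n * (64 * σ * q)   ≡⟨ lemma n σ q ⟩
      3072 * σ * n * q        ∎
      where
      lemma : ∀ n s q → 48 * n * (64 * s * q) ≡ 3072 * s * n * q
      lemma = solve-∀

    -- The origin of 12288 = 4 · 48 · 64, and the place where σ must be at least a constant times
    -- √n.
    4u≤σ³ : 2 * 2 * u ≤ σ ^ 3
    4u≤σ³ = begin
      2 * 2 * (3072 * σ * n)  ≡⟨ lemma σ n ⟩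
      σ * (12288 * n)         ≤⟨ *-monoʳ-≤ σ 12288n≤σ² ⟩
      σ * (σ * σ)             ≡⟨ cong (λ k → σ * (σ * k)) (*-identityʳ σ) ⟨
      σ ^ 3                   ∎
      where
      lemma : ∀ s n → 2 * 2 * (3072 * s * n) ≡ s * (12288 * n)
      lemma = solve-∀

    families-bound : wsum ρ 1 (families Q (triangles n) ∅) ≤ 2 ^ q * σ ^ (n * n)
    families-bound = *-cancelʳ-≤ _ _ ((σ ^ 3) ^ N) {{m^n≢0 (σ ^ 3) N {{m^n≢0 σ 3}}}} (begin
      wsum ρ 1 (families Q (triangles n) ∅) * (σ ^ 3) ^ N  ≤⟨ families-mean Q (triangles n) ∅ ⟩
      free {n * n} ∅ * (σ ^ 3 + 2) ^ N                     ≡⟨ cong (_* (σ ^ 3 + 2) ^ N) (product-const (n * n) σ) ⟩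
      σ ^ (n * n) * (σ ^ 3 + 2) ^ N                        ≤⟨ *-monoʳ-≤ (σ ^ (n * n)) (pow-growth (σ ^ 3) 2 u q N {{m^n≢0 σ 3}} 4u≤σ³ N≤uq) ⟩
      σ ^ (n * n) * (2 ^ q * (σ ^ 3) ^ N)                  ≡⟨ lemma (σ ^ (n * n)) (2 ^ q) _ ⟩
      2 ^ q * σ ^ (n * n) * (σ ^ 3) ^ N                    ∎)
      where
      lemma : ∀ a b c → a * (b * c) ≡ b * a * c
      lemma = solve-∀

    many-mean : wsum ρ 1 many * 2 ^ q ≤ σ ^ (n * n)
    many-mean = cancel-2^ q q (wsum ρ 1 many) _ (begin
      wsum ρ 1 many * 2 ^ (q + q)             ≡⟨ cong (λ e → wsum ρ 1 many * 2 ^ e) (cong (q +_) (+-identityʳ q)) ⟨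
      wsum ρ 1 many * 2 ^ (2 * q)             ≡⟨ wsum-*ʳ ρ 1 many (2 ^ (2 * q)) ⟨
      wsum ρ 1 (λ x → many x * 2 ^ (2 * q))   ≤⟨ wsum-mono ρ 1 markov ⟩
      wsum ρ 1 (families Q (triangles n) ∅)   ≤⟨ families-bound ⟩
      2 ^ q * σ ^ (n * n)                     ∎)
      where
      markov : ∀ x → many x * 2 ^ (2 * q) ≤ families Q (triangles n) ∅ x
      markov x = ind≤-guard {2 ^ (2 * q)} {families Q (triangles n) ∅ x} (λ h → h)

-- The graph of surviving arcs

not-true : ∀ {b} → not b ≡ true → b ≡ false
not-true {false} _ = refl

∧-intro : ∀ {a b} → a ≡ true → b ≡ true → a ∧ b ≡ true
∧-intro refl refl = refl

-- Arcs from a vertex to itself are sampled like all others and discarded only here.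
digraphAdj : ∀ n → Subset (n * n) → Fin n → Fin n → Bool
digraphAdj n y u v = not (does (u ≟ᶠ v)) ∧ (y (combine u v) ∨ y (combine v u))

digraphAdj-sym : ∀ n y u v → digraphAdj n y u v ≡ digraphAdj n y v u
digraphAdj-sym n y u v with u ≟ᶠ v | v ≟ᶠ u
... | yes _ | yes _ = refl
... | no _  | no _  = ∨-comm (y (combine u v)) _
... | yes p | no q  = ⊥-elim (q (sym p))
... | no p  | yes q = ⊥-elim (p (sym q))

digraphAdj-irrefl : ∀ n y v → digraphAdj n y v v ≡ false
digraphAdj-irrefl n y v with v ≟ᶠ v
... | yes _ = refl
... | no p  = ⊥-elim (p refl)

digraphAdj⇒arc : ∀ n y u v → digraphAdj n y u v ≡ true → u ≢ v × ∃ λ b → y (arc b u v) ≡ true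
digraphAdj⇒arc n y u v h with u ≟ᶠ v
... | no u≢v with ∨-split {y (combine u v)} h
...   | inj₁ p = u≢v , true , p
...   | inj₂ p = u≢v , false , p

survivorGraph : ∀ n → Subset (n * n) → Graph n
survivorGraph n x = record
  { adj    = digraphAdj n (survivors n x)
  ; sym    = digraphAdj-sym n (survivors n x)
  ; irrefl = digraphAdj-irrefl n (survivors n x)
  }

-- A surviving triangle would be present in x and disjoint from all chosen ones, against maximality.
survivorGraph-triangleFree : ∀ n x → TriangleFree (survivorGraph n x)
survivorGraph-triangleFree n x u v w uv vw uw
  with digraphAdj⇒arc n (survivors n x) u v uv | digraphAdj⇒arc n (survivors n x) v w vw
     | digraphAdj⇒arc n (survivors n x) u w uw
... | u≢v , a , ha | v≢w , b , hb | u≢w , c , hc with ∈-triangles u≢v u≢w v≢w a b c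
... | t , t∈ , refl , refl , refl with trans (sym meets-deleted) (greedy-maximal x ∅ t∈ inside-x)
  where
  deleted : Subset (n * n)
  deleted = greedy (triangles n) x ∅
  alive : ∀ i → survivors n x i ≡ true → x i ≡ true × deleted i ≡ false
  alive i h = let p , q = ∧-split {x i} h in p , not-true q
  inside-x : inside t x ≡ true
  inside-x = ∧-intro (proj₁ (alive _ ha)) (∧-intro (proj₁ (alive _ hb)) (proj₁ (alive _ hc)))
  meets-deleted : meets t deleted ≡ false
  meets-deleted rewrite proj₂ (alive _ ha) | proj₂ (alive _ hb) = proj₂ (alive _ hc)
... | ()

-- Arc sets of stars, rectangles and pairs of vertex sets

pairs : (Fin n → Fin n → Bool) → Subset (n * n)
pairs {n} P i = uncurry P (remQuot {n} n i)

edges-pairs : ∀ (P : Fin n → Fin n → Bool) y →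
              edges (pairs P) y ≡ sum (λ u → sum (λ v → ind (P u v ∧ y (combine u v))))
edges-pairs {n} P y = trans (count≡sum (λ i → pairs P i ∧ y i)) (trans (sum-combine {n} (λ i → ind (pairs P i ∧ y i)))
  (sum-cong-≗ {n} λ u → sum-cong-≗ {n} λ v → cong (λ uv → ind (uncurry P uv ∧ y (combine u v))) (remQuot-combine u v)))

count-pairs : ∀ (P : Fin n → Fin n → Bool) → count (pairs P) ≡ sum (λ u → sum (λ v → ind (P u v)))
count-pairs {n} P = trans (count≡sum (pairs P)) (trans (sum-combine {n} (λ i → ind (pairs P i)))
  (sum-cong-≗ {n} λ u → sum-cong-≗ {n} λ v → cong (λ uv → ind (uncurry P uv)) (remQuot-combine u v)))

singleton : Fin n → Subset n
singleton v u = does (v ≟ᶠ u)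

count-∅ : ∀ n → count {n} (λ _ → false) ≡ 0
count-∅ zero    = refl
count-∅ (suc n) = count-∅ n

count-full : ∀ n → count {n} (λ _ → true) ≡ n
count-full zero    = refl
count-full (suc n) = cong suc (count-full n)

count-singleton : ∀ (v : Fin n) → count (singleton v) ≡ 1
count-singleton {suc n} zero    = cong suc (count-∅ n)
count-singleton {suc n} (suc v) = count-singleton v

rect : Subset n → Subset n → Fin n → Fin n → Bool
rect A B u v = A u ∧ B v ∧ not (does (u ≟ᶠ v))

count-remove : ∀ (B : Subset n) u → count B ≤ sum (λ v → ind (B v ∧ not (does (u ≟ᶠ v)))) + 1
count-remove {n} B u = begin
  count B                                                     ≡⟨ count≡sum B ⟩
  sum (ind ∘ B)                                               ≤⟨ sum-mono {n} (λ v → split (B v) (does (u ≟ᶠ v))) ⟩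
  sum (λ v → ind (B v ∧ not (does (u ≟ᶠ v))) + ind (does (u ≟ᶠ v)))
    ≡⟨ ∑-distrib-+ {n} (λ v → ind (B v ∧ not (does (u ≟ᶠ v)))) (λ v → ind (does (u ≟ᶠ v))) ⟩
  sum (λ v → ind (B v ∧ not (does (u ≟ᶠ v)))) + sum (λ v → ind (singleton u v))
    ≡⟨ cong (sum (λ v → ind (B v ∧ not (does (u ≟ᶠ v)))) +_) (trans (sym (count≡sum (singleton u))) (count-singleton u)) ⟩
  sum (λ v → ind (B v ∧ not (does (u ≟ᶠ v)))) + 1             ∎
  where
  split : ∀ b d → ind b ≤ ind (b ∧ not d) + ind d
  split false d     = z≤n
  split true  true  = ≤-refl
  split true  false = ≤-refl

-- Each u in A loses at most the one pair (u, u).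
count-rect : ∀ (A B : Subset n) → count A * count B ≤ count (pairs (rect A B)) + count A
count-rect {n} A B = begin
  count A * count B                                         ≡⟨ cong (_* count B) (count≡sum A) ⟩
  sum (ind ∘ A) * count B                                   ≡⟨ *-distribʳ-sum {n} (count B) (ind ∘ A) ⟩
  sum (λ u → ind (A u) * count B)                           ≤⟨ sum-mono {n} row ⟩
  sum (λ u → sum (λ v → ind (rect A B u v)) + ind (A u))    ≡⟨ ∑-distrib-+ {n} (λ u → sum (λ v → ind (rect A B u v))) (ind ∘ A) ⟩
  sum (λ u → sum (λ v → ind (rect A B u v))) + sum (ind ∘ A) ≡⟨ cong₂ _+_ (count-pairs (rect A B)) (count≡sum A) ⟨
  count (pairs (rect A B)) + count A                        ∎
  where
  row : ∀ u → ind (A u) * count B ≤ sum (λ v → ind (rect A B u v)) + ind (A u)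
  row u with A u
  ... | true  = ≤-trans (≤-reflexive (+-identityʳ _)) (count-remove B u)
  ... | false = z≤n

star : Fin n → Subset (n * n)
star v = pairs (rect (singleton v) (λ _ → true))

count-star : ∀ (v : Fin n) → n ≤ count (star v) + 1
count-star {n} v = begin
  n                                             ≡⟨ trans (cong₂ _*_ (count-singleton v) (count-full n)) (*-identityˡ n) ⟨
  count (singleton v) * count {n} (λ _ → true)  ≤⟨ count-rect (singleton v) (λ _ → true) ⟩
  count (star v) + count (singleton v)          ≡⟨ cong (count (star v) +_) (count-singleton v) ⟩
  count (star v) + 1                            ∎

-- The star holds only arcs leaving v, so distinct surviving arcs lead to distinct neighbours.
edges-star : ∀ n x (v : Fin n) → edges (star v) (survivors n x) ≤ deg (survivorGraph n x) v
edges-star n x v = begin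
  edges (star v) y                         ≡⟨ edges-pairs (rect (singleton v) (λ _ → true)) y ⟩
  sum row                                  ≤⟨ sum-mono {n} only-v ⟩
  sum (λ u → ind (singleton v u) * row v)  ≡⟨ *-distribʳ-sum {n} (row v) (λ u → ind (singleton v u)) ⟨
  sum (ind ∘ singleton v) * row v          ≡⟨ cong (_* row v) (trans (sym (count≡sum (singleton v))) (count-singleton v)) ⟩
  1 * row v                                ≡⟨ *-identityˡ _ ⟩
  row v                                    ≤⟨ sum-mono {n} neighbour ⟩
  sum (ind ∘ digraphAdj n y v)             ≡⟨ count≡sum (digraphAdj n y v) ⟨
  deg (survivorGraph n x) v                ∎
  where
  y : Subset (n * n)
  y = survivors n x
  row : Fin n → ℕ
  row u = sum (λ w → ind (rect (singleton v) (λ _ → true) u w ∧ y (combine u w)))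
  only-v : ∀ u → row u ≤ ind (singleton v u) * row v
  only-v u with v ≟ᶠ u
  ... | no _     = ≤-reflexive (trans (sum-const n 0) (*-zeroʳ n))
  ... | yes refl with v ≟ᶠ v
  ...   | yes _ = ≤-reflexive (sym (+-identityʳ _))
  ...   | no p  = ⊥-elim (p refl)
  bound : ∀ s d a b → ind ((s ∧ true ∧ not d) ∧ a) ≤ ind (not d ∧ (a ∨ b))
  bound false d     a     b = z≤n
  bound true  true  a     b = z≤n
  bound true  false true  b = ≤-refl
  bound true  false false b = z≤n
  neighbour : ∀ w → ind (rect (singleton v) (λ _ → true) v w ∧ y (combine v w)) ≤ ind (digraphAdj n y v w)
  neighbour w = bound (singleton v v) (does (v ≟ᶠ w)) (y (combine v w)) (y (combine w v))

edges-stable : ∀ n y (A : Subset n) → (∀ u v → A u ≡ true → A v ≡ true → digraphAdj n y u v ≡ false) →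
               edges (pairs (rect A A)) y ≡ 0
edges-stable n y A stable = n≤0⇒n≡0 (begin
  edges (pairs (rect A A)) y
    ≡⟨ edges-pairs (rect A A) y ⟩
  sum (λ u → sum (λ v → ind (rect A A u v ∧ y (combine u v))))
    ≤⟨ sum-mono {n} (λ u → sum-mono {n} (λ v → bound (A u) (A v) (does (u ≟ᶠ v)) (y (combine u v)) _ (stable u v))) ⟩
  sum {n} (λ u → sum {n} (λ v → 0))
    ≡⟨ trans (sum-cong-≗ {n} (λ _ → trans (sum-const n 0) (*-zeroʳ n))) (trans (sum-const n 0) (*-zeroʳ n)) ⟩
  0 ∎)
  where
  bound : ∀ a b d p q → (a ≡ true → b ≡ true → not d ∧ (p ∨ q) ≡ false) → ind ((a ∧ b ∧ not d) ∧ p) ≤ 0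
  bound false b     d     p     q h = z≤n
  bound true  false d     p     q h = z≤n
  bound true  true  true  p     q h = z≤n
  bound true  true  false false q h = z≤n
  bound true  true  false true  q h with () ← h refl refl

cross : Subset n → Subset n → Fin n → Fin n → Bool
cross A B u v = (A u ∧ B v) ∨ (B u ∧ A v)

count-cross : ∀ (A B : Subset n) → count (pairs (cross A B)) ≤ 2 * (count A * count B)
count-cross {n} A B = begin
  count (pairs (cross A B))
    ≡⟨ count-pairs (cross A B) ⟩
  sum (λ u → sum (λ v → ind (cross A B u v)))
    ≤⟨ sum-mono {n} (λ u → sum-mono {n} (λ v → bound (A u) (B v) (B u) (A v))) ⟩
  sum (λ u → sum (λ v → a u * b v + b u * a v))
    ≡⟨ sum-cong-≗ {n} (λ u → ∑-distrib-+ {n} (λ v → a u * b v) (λ v → b u * a v)) ⟩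
  sum (λ u → sum (λ v → a u * b v) + sum (λ v → b u * a v))
    ≡⟨ ∑-distrib-+ {n} (λ u → sum (λ v → a u * b v)) (λ u → sum (λ v → b u * a v)) ⟩
  sum (λ u → sum (λ v → a u * b v)) + sum (λ u → sum (λ v → b u * a v))
    ≡⟨ cong₂ _+_ (sum-*-sum a b) (sum-*-sum b a) ⟩
  sum a * sum b + sum b * sum a
    ≡⟨ cong₂ (λ s t → s * t + t * s) (count≡sum A) (count≡sum B) ⟨
  count A * count B + count B * count A
    ≡⟨ lemma (count A) (count B) ⟩
  2 * (count A * count B) ∎
  where
  a b : Fin n → ℕ
  a = ind ∘ A
  b = ind ∘ B
  lemma : ∀ a b → a * b + b * a ≡ 2 * (a * b)
  lemma = solve-∀
  bound : ∀ p q r s → ind ((p ∧ q) ∨ (r ∧ s)) ≤ ind p * ind q + ind r * ind s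
  bound true  true  r     s     = s≤s z≤n
  bound true  false true  true  = ≤-refl
  bound true  false true  false = z≤n
  bound true  false false s     = z≤n
  bound false q     true  true  = ≤-refl
  bound false q     true  false = z≤n
  bound false q     false s     = z≤n

-- Double counting: every edge from v in B to A comes from an arc of x in one of the two directions,
-- and disjointness of A and B prevents an arc from being counted twice.
edges-cross : ∀ n x (A B : Subset n) t → (∀ v → A v ≡ true → B v ≡ false) →
              (∀ v → B v ≡ true → t ≤ count (λ u → A u ∧ adj (survivorGraph n x) v u)) →
              t * count B ≤ edges (pairs (cross A B)) x
edges-cross n x A B t disj large = begin
  t * count B                                  ≡⟨ trans (cong (t *_) (count≡sum B)) (*-distribˡ-sum {n} t (ind ∘ B)) ⟩
  sum (λ v → t * ind (B v))                    ≤⟨ sum-mono {n} row ⟩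
  sum (λ v → sum (λ u → F v u + G u v))        ≡⟨ sum-cong-≗ {n} (λ v → ∑-distrib-+ {n} (F v) (λ u → G u v)) ⟩
  sum (λ v → sum (F v) + sum (λ u → G u v))    ≡⟨ ∑-distrib-+ {n} (λ v → sum (F v)) (λ v → sum (λ u → G u v)) ⟩
  sum (λ v → sum (F v)) + sum (λ v → sum (λ u → G u v))
    -- `G u v` counts an arc from u in A to v in B. Swapping the sums lists it by its tail, as
    -- `pairs` does.
    ≡⟨ cong (sum (λ v → sum (F v)) +_) (∑-comm {n} {n} (λ v u → G u v)) ⟩
  sum (λ v → sum (F v)) + sum (λ v → sum (G v)) ≡⟨ ∑-distrib-+ {n} (λ v → sum (F v)) (λ v → sum (G v)) ⟨
  sum (λ v → sum (F v) + sum (G v))            ≡⟨ sum-cong-≗ {n} (λ v → ∑-distrib-+ {n} (F v) (G v)) ⟨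
  sum (λ v → sum (λ u → F v u + G v u))        ≤⟨ sum-mono {n} (λ v → sum-mono {n} (λ u →
                                                    merge (A v) (B u) (B v) (A u) (x (combine v u)) (disj v))) ⟩
  sum (λ v → sum (λ u → ind (cross A B v u ∧ x (combine v u)))) ≡⟨ edges-pairs (cross A B) x ⟨
  edges (pairs (cross A B)) x                  ∎
  where
  F G : Fin n → Fin n → ℕ
  F v u = ind ((B v ∧ A u) ∧ x (combine v u))
  G v u = ind ((A v ∧ B u) ∧ x (combine v u))
  merge : ∀ p q r s z → (p ≡ true → r ≡ false) →
          ind ((r ∧ s) ∧ z) + ind ((p ∧ q) ∧ z) ≤ ind (((p ∧ q) ∨ (r ∧ s)) ∧ z)
  merge true  q     true  s     z h with () ← h refl
  merge true  true  false s     z h = ≤-refl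
  merge true  false false s     z h = z≤n
  merge false q     true  s     z h = ≤-reflexive (+-identityʳ _)
  merge false q     false s     z h = z≤n
  arcBound : ∀ a d p p′ q q′ → ind (a ∧ not d ∧ ((p ∧ p′) ∨ (q ∧ q′))) ≤ ind (a ∧ p) + ind ((a ∧ true) ∧ q)
  arcBound false d     p     p′    q     q′    = z≤n
  arcBound true  true  p     p′    q     q′    = z≤n
  arcBound true  false true  true  q     q′    = s≤s z≤n
  arcBound true  false true  false true  q′    = ≤-trans (ind≤1 q′) (s≤s z≤n)
  arcBound true  false true  false false q′    = z≤n
  arcBound true  false false p′    true  q′    = ind≤1 q′
  arcBound true  false false p′    false q′    = z≤n
  row : ∀ v → t * ind (B v) ≤ sum (λ u → F v u + G u v)
  row v with B v | large v
  ... | false | _     = ≤-trans (≤-reflexive (*-zeroʳ t)) z≤n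
  ... | true  | large = begin
    t * 1                                                  ≡⟨ *-identityʳ t ⟩
    t                                                      ≤⟨ large refl ⟩
    count (λ u → A u ∧ adj (survivorGraph n x) v u)        ≡⟨ count≡sum (λ u → A u ∧ adj (survivorGraph n x) v u) ⟩
    sum (λ u → ind (A u ∧ adj (survivorGraph n x) v u))    ≤⟨ sum-mono {n} (λ u → arcBound (A u) (does (v ≟ᶠ u))
                                                                (x (combine v u)) _ (x (combine u v)) _) ⟩
    sum (λ u → ind (A u ∧ x (combine v u)) + ind ((A u ∧ true) ∧ x (combine u v))) ∎

-- Union bound

member⇒count : ∀ (A : Subset n) v → A v ≡ true → 1 ≤ count A
member⇒count A v h = ≤-trans (≤-trans (≤-reflexive (cong ind (sym h))) (term≤sum (ind ∘ A) v))
                             (≤-reflexive (sym (count≡sum A)))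

module RandomGraph
  (ρ u n L : ℕ) (σ≡2u : suc ρ ≡ 2 * u) .{{_ : NonZero n}}
  (12288n≤σ² : 12288 * n ≤ suc ρ * suc ρ)
  (n≤2^L : n ≤ 2 ^ L)
  (n-large : 32 * suc ρ * (L + 4) + 1 ≤ n) where

  open Tails ρ
  open BadEvents ρ n 12288n≤σ²

  -- `K` ≥ 2n is the charge per vertex in `wsum-subsets`. In `α`, L + 6 = (L + 1) + 5, where L + 1
  -- pays for `K` and 5 for constants. Between sets of sizes a ≤ `α` and b there are at most 2ab ≤
  -- (σ/2)`β`b arcs, and `t` exceeds `β` by 7(L + 6) to pay for the choice of both sets.
  total K α β t : ℕ
  total = σ ^ (n * n)
  K = 2 ^ suc L
  α = 32 * σ * (L + 6)
  β = 128 * (L + 6)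
  t = 135 * (L + 6)

  instance
    K≢0 : NonZero K
    K≢0 = m^n≢0 2 (suc L)

  2n≤K : 2 * n ≤ K
  2n≤K = *-monoʳ-≤ 2 n≤2^L

  -- The largest q meeting the lower size condition of `bad-mean`; once q ≥ 1, the upper one follows
  -- from |Q| < 32σ(q + 1) ≤ 64σq.
  quota : Subset (n * n) → ℕ
  quota Q = count Q / (32 * σ)

  quota-lower : ∀ Q → 32 * σ * quota Q ≤ count Q
  quota-lower Q = ≤-trans (≤-reflexive (*-comm (32 * σ) _)) (m/n*n≤m (count Q) (32 * σ))

  quota-upper : ∀ Q → count Q < 32 * σ * suc (quota Q)
  quota-upper Q = begin-strict
    count Q                                          ≡⟨ m≡m%n+[m/n]*n (count Q) (32 * σ) ⟩
    count Q % (32 * σ) + quota Q * (32 * σ)          <⟨ +-monoˡ-< (quota Q * (32 * σ)) (m%n<n (count Q) (32 * σ)) ⟩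
    32 * σ + quota Q * (32 * σ)                      ≡⟨ *-comm (suc (quota Q)) (32 * σ) ⟩
    32 * σ * suc (quota Q)                           ∎

  quota-≥ : ∀ Q j → 32 * σ * j ≤ count Q → j ≤ quota Q
  quota-≥ Q j h = s≤s⁻¹ (*-cancelˡ-< (32 * σ) j (suc (quota Q)) (≤-<-trans h (quota-upper Q)))

  badness : Subset (n * n) → Subset (n * n) → ℕ
  badness Q = bad n Q (quota Q)

  badness-mean : ∀ Q j → 1 ≤ j → 32 * σ * j ≤ count Q → wsum ρ 1 (badness Q) * 2 ^ j ≤ 2 * total
  badness-mean Q j 1≤j h = begin
    wsum ρ 1 (badness Q) * 2 ^ j        ≤⟨ *-monoʳ-≤ (wsum ρ 1 (badness Q)) (^-monoʳ-≤ 2 j≤q) ⟩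
    wsum ρ 1 (badness Q) * 2 ^ quota Q  ≤⟨ bad-mean Q (quota Q) (quota-lower Q) hi ⟩
    2 * total                           ∎
    where
    j≤q : j ≤ quota Q
    j≤q = quota-≥ Q j h
    lemma : ∀ s q → 32 * s * (q + q) ≡ 64 * s * q
    lemma = solve-∀
    hi : count Q ≤ 64 * σ * quota Q
    hi = begin
      count Q                            ≤⟨ <⇒≤ (quota-upper Q) ⟩
      32 * σ * suc (quota Q)             ≤⟨ *-monoʳ-≤ (32 * σ) (+-monoˡ-≤ (quota Q) (≤-trans 1≤j j≤q)) ⟩
      32 * σ * (quota Q + quota Q)       ≡⟨ lemma σ (quota Q) ⟩
      64 * σ * quota Q                   ∎

  starLoss : Subset (n * n) → ℕ
  starLoss x = sum (λ v → badness (star {n} v) x)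

  -- Each of the n stars fails with probability at most 2 · 2^(-L-4) ≤ 1/(8n).
  starLoss-mean : 8 * wsum ρ 1 starLoss ≤ total
  starLoss-mean = *-cancelʳ-≤ _ _ n (begin
    8 * wsum ρ 1 starLoss * n             ≡⟨ cong (λ k → 8 * k * n) (wsum-sum ρ 1 (λ x v → badness (star {n} v) x)) ⟩
    8 * sum w * n                         ≡⟨ rearrange₁ (sum w) n ⟩
    sum w * (8 * n)                       ≡⟨ *-distribʳ-sum {n} (8 * n) w ⟩
    sum (λ v → w v * (8 * n))             ≤⟨ sum-mono {n} each ⟩
    sum {n} (λ _ → total)                 ≡⟨ trans (sum-const n total) (*-comm n total) ⟩
    total * n                             ∎)
    where
    w : Fin n → ℕ
    w v = wsum ρ 1 (badness (star v))
    rearrange₁ : ∀ a n → 8 * a * n ≡ a * (8 * n)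
    rearrange₁ = solve-∀
    rearrange₂ : ∀ a b → 2 * (a * (8 * b)) ≡ a * (b * 16)
    rearrange₂ = solve-∀
    each : ∀ v → w v * (8 * n) ≤ total
    each v = *-cancelˡ-≤ 2 (begin
      2 * (w v * (8 * n))          ≤⟨ *-monoʳ-≤ 2 (*-monoʳ-≤ (w v) (*-monoʳ-≤ 8 n≤2^L)) ⟩
      2 * (w v * (8 * 2 ^ L))      ≡⟨ rearrange₂ (w v) (2 ^ L) ⟩
      w v * (2 ^ L * 2 ^ 4)        ≡⟨ cong (w v *_) (^-distribˡ-+-* 2 L 4) ⟨
      w v * 2 ^ (L + 4)            ≤⟨ badness-mean (star v) (L + 4) (m≤n⇒m≤o+n L (s≤s z≤n))
                                        (+-cancelʳ-≤ 1 _ _ (≤-trans n-large (count-star v))) ⟩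
      2 * total                    ∎)

  stableLoss : Subset n → Subset (n * n) → ℕ
  stableLoss A x = ind≤ (suc α) (count A) * badness (pairs (rect A A)) x

  -- For a = |A| > `α` the a² - a ordered pairs are at least 32σ(5 + (L + 1)a), so failure has
  -- probability at most 2 · 2^(-5) `K`^(-a).
  stableLoss-mean : ∀ A → 16 * wsum ρ 1 (stableLoss A) * K ^ count A ≤ total
  stableLoss-mean A = begin
    16 * wsum ρ 1 (stableLoss A) * K ^ a         ≡⟨ cong (λ k → 16 * k * K ^ a) (wsum-*ˡ ρ 1 (ind≤ (suc α) a) (badness Q)) ⟩
    16 * (ind≤ (suc α) a * w) * K ^ a            ≡⟨ rearrange₁ (ind≤ (suc α) a) w (K ^ a) ⟩
    ind≤ (suc α) a * (16 * (w * K ^ a))          ≤⟨ ind≤-guard {suc α} {a} large ⟩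
    total                                        ∎
    where
    a w : ℕ
    Q : Subset (n * n)
    a = count A
    Q = pairs (rect A A)
    w = wsum ρ 1 (badness Q)
    rearrange₁ : ∀ i w k → 16 * (i * w) * k ≡ i * (16 * (w * k))
    rearrange₁ = solve-∀
    rearrange₂ : ∀ w k → 2 * (16 * (w * k)) ≡ w * (32 * k)
    rearrange₂ = solve-∀
    rearrange₃ : ∀ s L a → 32 * s * (5 * a + (1 + L) * a) + a ≡ (1 + 32 * s * (L + 6)) * a
    rearrange₃ = solve-∀
    large : suc α ≤ a → 16 * (w * K ^ a) ≤ total
    large T≤a = *-cancelˡ-≤ 2 (begin
      2 * (16 * (w * K ^ a))        ≡⟨ rearrange₂ w (K ^ a) ⟩
      w * (2 ^ 5 * K ^ a)           ≡⟨ cong (λ k → w * (2 ^ 5 * k)) (^-*-assoc 2 (suc L) a) ⟩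
      w * (2 ^ 5 * 2 ^ (suc L * a)) ≡⟨ cong (w *_) (^-distribˡ-+-* 2 5 (suc L * a)) ⟨
      w * 2 ^ (5 + suc L * a)       ≤⟨ badness-mean Q (5 + suc L * a) (s≤s z≤n) many-pairs ⟩
      2 * total                     ∎)
      where
      many-pairs : 32 * σ * (5 + suc L * a) ≤ count Q
      many-pairs = +-cancelʳ-≤ a _ _ (begin
        32 * σ * (5 + suc L * a) + a      ≤⟨ +-monoˡ-≤ a (*-monoʳ-≤ (32 * σ) (+-monoˡ-≤ (suc L * a) (*-monoʳ-≤ 5 (≤-trans (s≤s z≤n) T≤a)))) ⟩
        32 * σ * (5 * a + suc L * a) + a  ≡⟨ rearrange₃ σ L a ⟩
        suc α * a                         ≤⟨ *-monoˡ-≤ a T≤a ⟩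
        a * a                             ≤⟨ count-rect A A ⟩
        count Q + a                       ∎)

  stableLoss-total : 8 * wsum ρ 1 (λ x → wsum 1 1 (λ A → stableLoss A x)) ≤ total
  stableLoss-total = *-cancelˡ-≤ 2 (begin
    2 * (8 * wsum ρ 1 (λ x → wsum 1 1 (λ A → stableLoss A x)))  ≡⟨ *-assoc 2 8 (wsum ρ 1 (λ x → wsum 1 1 (λ A → stableLoss A x))) ⟨
    16 * wsum ρ 1 (λ x → wsum 1 1 (λ A → stableLoss A x))       ≡⟨ cong (16 *_) (wsum-comm ρ 1 1 1 (λ x A → stableLoss A x)) ⟩
    16 * wsum 1 1 (λ A → wsum ρ 1 (stableLoss A))               ≡⟨ wsum-*ˡ 1 1 16 (λ A → wsum ρ 1 (stableLoss A)) ⟨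
    wsum 1 1 (λ A → 16 * wsum ρ 1 (stableLoss A))               ≤⟨ wsum-subsets (λ A → 16 * wsum ρ 1 (stableLoss A)) K total 2n≤K stableLoss-mean ⟩
    2 * total                                                   ∎)

  denseEvent : Subset n → Subset n → Subset (n * n) → ℕ
  denseEvent A B x = ind≤ (t * count B) (edges (pairs (cross A B)) x)

  -- An empty B must be excluded: its event reads 0 ≤ 0 and always holds.
  denseGuard : Subset n → Subset n → ℕ
  denseGuard A B = ind≤ (count A) α * (ind≤ (count A) (count B) * ind≤ 1 (count B))

  denseLoss : Subset n → Subset n → Subset (n * n) → ℕ
  denseLoss A B x = denseGuard A B * denseEvent A B x

  -- The upper tail with u = σ/2 gives 2^(βb-tb) = 2^(-7(L+6)b). Since a ≤ b, the charge for both
  -- sets is at most `K`^(2b) = 2^(2(L+1)b), and b ≥ 1 lets the rest of the exponent absorb the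
  -- factor 32.
  denseLoss-mean : ∀ A B → 32 * wsum ρ 1 (denseLoss A B) * K ^ count A * K ^ count B ≤ total
  denseLoss-mean A B = begin
    32 * wsum ρ 1 (denseLoss A B) * K ^ a * K ^ b
      ≡⟨ cong (λ k → 32 * k * K ^ a * K ^ b) (wsum-*ˡ ρ 1 (denseGuard A B) (denseEvent A B)) ⟩
    32 * (denseGuard A B * w) * K ^ a * K ^ b
      ≡⟨ rearrange₁ (ind≤ a α) (ind≤ a b) (ind≤ 1 b) w (K ^ a) (K ^ b) ⟩
    ind≤ a α * (ind≤ a b * (ind≤ 1 b * (32 * w * K ^ a * K ^ b)))
      ≤⟨ ind≤-guard {a} {α} (λ a≤α → ind≤-guard {a} {b} (λ a≤b → ind≤-guard {1} {b} (λ 1≤b → guarded a≤α a≤b 1≤b))) ⟩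
    total ∎
    where
    a b w : ℕ
    Q : Subset (n * n)
    a = count A
    b = count B
    Q = pairs (cross A B)
    w = wsum ρ 1 (denseEvent A B)
    rearrange₁ : ∀ i j k w p q → 32 * (i * (j * k) * w) * p * q ≡ i * (j * (k * (32 * w * p * q)))
    rearrange₁ = solve-∀
    rearrange₂ : ∀ w p → 32 * w * p * p ≡ w * (32 * (p * p))
    rearrange₂ = solve-∀
    rearrange₃ : ∀ u L b → 2 * (32 * (2 * u) * (L + 6) * b) ≡ u * (128 * (L + 6) * b)
    rearrange₃ = solve-∀
    rearrange₄ : ∀ L b → 135 * (L + 6) * b ≡ 128 * (L + 6) * b + 7 * (L + 6) * b
    rearrange₄ = solve-∀
    rearrange₅ : ∀ L b → 5 * b + ((1 + L) * b + (1 + L) * b) + (5 * L + 35) * b ≡ 7 * (L + 6) * b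
    rearrange₅ = solve-∀
    guarded : a ≤ α → a ≤ b → 1 ≤ b → 32 * w * K ^ a * K ^ b ≤ total
    guarded a≤α a≤b 1≤b = begin
      32 * w * K ^ a * K ^ b           ≤⟨ *-monoˡ-≤ (K ^ b) (*-monoʳ-≤ (32 * w) (^-monoʳ-≤ K a≤b)) ⟩
      32 * w * K ^ b * K ^ b           ≡⟨ rearrange₂ w (K ^ b) ⟩
      w * (2 ^ 5 * (K ^ b * K ^ b))    ≡⟨ cong (λ k → w * (2 ^ 5 * (k * k))) (^-*-assoc 2 (suc L) b) ⟩
      w * (2 ^ 5 * (2 ^ (suc L * b) * 2 ^ (suc L * b))) ≡⟨ cong (λ k → w * (2 ^ 5 * k)) (^-distribˡ-+-* 2 (suc L * b) (suc L * b)) ⟨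
      w * (2 ^ 5 * 2 ^ (suc L * b + suc L * b)) ≡⟨ cong (w *_) (^-distribˡ-+-* 2 5 (suc L * b + suc L * b)) ⟨
      w * 2 ^ (5 + (suc L * b + suc L * b))     ≤⟨ *-monoʳ-≤ w (^-monoʳ-≤ 2 exponent) ⟩
      w * 2 ^ (7 * (L + 6) * b)        ≤⟨ cancel-2^ (β * b) (7 * (L + 6) * b) w total tail ⟩
      total                            ∎
      where
      exponent : 5 + (suc L * b + suc L * b) ≤ 7 * (L + 6) * b
      exponent = begin
        5 + (suc L * b + suc L * b)                        ≤⟨ +-monoˡ-≤ (suc L * b + suc L * b) (*-monoʳ-≤ 5 1≤b) ⟩
        5 * b + (suc L * b + suc L * b)                    ≤⟨ m≤m+n _ ((5 * L + 35) * b) ⟩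
        5 * b + (suc L * b + suc L * b) + (5 * L + 35) * b ≡⟨ rearrange₅ L b ⟩
        7 * (L + 6) * b                                    ∎
      few-pairs : count Q ≤ u * (β * b)
      few-pairs = begin
        count Q                              ≤⟨ count-cross A B ⟩
        2 * (a * b)                          ≤⟨ *-monoʳ-≤ 2 (*-monoˡ-≤ b a≤α) ⟩
        2 * (32 * σ * (L + 6) * b)           ≡⟨ cong (λ s → 2 * (32 * s * (L + 6) * b)) σ≡2u ⟩
        2 * (32 * (2 * u) * (L + 6) * b)     ≡⟨ rearrange₃ u L b ⟩
        u * (β * b)                          ∎
      tail : w * 2 ^ (β * b + 7 * (L + 6) * b) ≤ 2 ^ (β * b) * total
      tail = ≤-trans (≤-reflexive (cong (λ e → w * 2 ^ e) (sym (rearrange₄ L b))))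
                     (upper-tail Q (t * b) u (β * b) (≤-reflexive (sym σ≡2u)) few-pairs)

  -- Summing over B and then over A costs a factor 2 each time, which turns 32 into 8.
  denseLoss-total : 8 * wsum ρ 1 (λ x → wsum 1 1 (λ A → wsum 1 1 (λ B → denseLoss A B x))) ≤ total
  denseLoss-total = *-cancelˡ-≤ 4 (begin
    4 * (8 * W)                              ≡⟨ *-assoc 4 8 W ⟨
    32 * W                                   ≡⟨ cong (32 *_) (trans (wsum-comm ρ 1 1 1 (λ x A → wsum 1 1 (λ B → denseLoss A B x)))
                                                  (wsum-cong 1 1 (λ A → wsum-comm ρ 1 1 1 (λ x B → denseLoss A B x)))) ⟩
    32 * wsum 1 1 (λ A → wsum 1 1 (w A))     ≡⟨ wsum-*ˡ 1 1 32 (λ A → wsum 1 1 (w A)) ⟨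
    wsum 1 1 (λ A → 32 * wsum 1 1 (w A))     ≤⟨ wsum-subsets (λ A → 32 * wsum 1 1 (w A)) K (2 * total) 2n≤K fixed-A ⟩
    2 * (2 * total)                          ≡⟨ *-assoc 2 2 total ⟨
    4 * total                                ∎)
    where
    W : ℕ
    W = wsum ρ 1 (λ x → wsum 1 1 (λ A → wsum 1 1 (λ B → denseLoss A B x)))
    w : Subset n → Subset n → ℕ
    w A B = wsum ρ 1 (denseLoss A B)
    fixed-A : ∀ A → 32 * wsum 1 1 (w A) * K ^ count A ≤ 2 * total
    fixed-A A = begin
      32 * wsum 1 1 (w A) * K ^ count A              ≡⟨ cong (_* K ^ count A) (wsum-*ˡ 1 1 32 (w A)) ⟨
      wsum 1 1 (λ B → 32 * w A B) * K ^ count A      ≡⟨ wsum-*ʳ 1 1 (λ B → 32 * w A B) (K ^ count A) ⟨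
      wsum 1 1 (λ B → 32 * w A B * K ^ count A)      ≤⟨ wsum-subsets (λ B → 32 * w A B * K ^ count A) K total 2n≤K (denseLoss-mean A) ⟩
      2 * total                                      ∎

  loss : Subset (n * n) → ℕ
  loss x = starLoss x + (wsum 1 1 (λ A → stableLoss A x) + wsum 1 1 (λ A → wsum 1 1 (λ B → denseLoss A B x)))

  loss-mean : wsum ρ 1 loss < total
  loss-mean = *-cancelˡ-< 8 _ _ (begin-strict
    8 * wsum ρ 1 loss                ≡⟨ cong (8 *_) (trans (wsum-+ ρ 1 starLoss restSum)
                                          (cong (wsum ρ 1 starLoss +_) (wsum-+ ρ 1 stableSum denseSum))) ⟩
    8 * (wsum ρ 1 starLoss + (wsum ρ 1 stableSum + wsum ρ 1 denseSum))
      ≡⟨ lemma (wsum ρ 1 starLoss) (wsum ρ 1 stableSum) (wsum ρ 1 denseSum) ⟩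
    8 * wsum ρ 1 starLoss + (8 * wsum ρ 1 stableSum + 8 * wsum ρ 1 denseSum)
      ≤⟨ +-mono-≤ starLoss-mean (+-mono-≤ stableLoss-total denseLoss-total) ⟩
    total + (total + total)          ≡⟨ cong (λ k → total + (total + k)) (+-identityʳ total) ⟨
    3 * total                        <⟨ *-monoˡ-< total {{m^n≢0 σ (n * n)}} {3} {8} (s≤s (s≤s (s≤s (s≤s z≤n)))) ⟩
    8 * total                        ∎)
    where
    stableSum denseSum restSum : Subset (n * n) → ℕ
    stableSum x = wsum 1 1 (λ A → stableLoss A x)
    denseSum x = wsum 1 1 (λ A → wsum 1 1 (λ B → denseLoss A B x))
    restSum x = stableSum x + denseSum x
    lemma : ∀ a b c → 8 * (a + (b + c)) ≡ 8 * a + (8 * b + 8 * c)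
    lemma = solve-∀

  lossless : ∃ λ x → loss x ≡ 0
  lossless = wsum-small⇒zero ρ 1 loss (subst (λ s → wsum ρ 1 loss < s ^ (n * n)) (+-comm 1 ρ) loss-mean)

  module Lossless (x : Subset (n * n)) (loss≡0 : loss x ≡ 0) where

    G : Graph n
    G = survivorGraph n x

    private
      star≡0 : starLoss x ≡ 0
      star≡0 = m+n≡0⇒m≡0 (starLoss x) loss≡0
      rest≡0 : wsum 1 1 (λ A → stableLoss A x) + wsum 1 1 (λ A → wsum 1 1 (λ B → denseLoss A B x)) ≡ 0
      rest≡0 = m+n≡0⇒n≡0 (starLoss x) loss≡0
      stable≡0 : wsum 1 1 (λ A → stableLoss A x) ≡ 0
      stable≡0 = m+n≡0⇒m≡0 _ rest≡0
      dense≡0 : wsum 1 1 (λ A → wsum 1 1 (λ B → denseLoss A B x)) ≡ 0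
      dense≡0 = m+n≡0⇒n≡0 (wsum 1 1 (λ A → stableLoss A x)) rest≡0

      ≤0 : ∀ {a b} → a ≤ b → b ≡ 0 → a ≡ 0
      ≤0 a≤b b≡0 = n≤0⇒n≡0 (≤-trans a≤b (≤-reflexive b≡0))

      ind≤-drop : ∀ {a b c} → a ≤ b → ind≤ a b * c ≡ 0 → c ≡ 0
      ind≤-drop {a} {b} {c} a≤b h = trans (sym (*-identityˡ c)) (trans (cong (_* c) (sym (ind≤-yes a≤b))) h)

    degree : ∀ v → n ≤ 32 * σ * deg G v
    degree v = begin
      n                                ≤⟨ count-star v ⟩
      count (star v) + 1               ≡⟨ +-comm (count (star v)) 1 ⟩
      -- Strictness in `quota-upper` absorbs the missing arc from v to itself, and strictness in
      -- `survivors-many` absorbs the rounding of the quota.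
      suc (count (star v))             ≤⟨ quota-upper (star v) ⟩
      32 * σ * suc (quota (star v))    ≤⟨ *-monoʳ-≤ (32 * σ) (≤-trans
                                            (survivors-many n (star v) (quota (star v)) x
                                              (≤0 (term≤sum (λ v → badness (star {n} v) x) v) star≡0))
                                            (edges-star n x v)) ⟩
      32 * σ * deg G v                 ∎

    stable-small : ∀ V → (∀ u v → V u ≡ true → V v ≡ true → adj G u v ≡ false) → count V ≤ α
    stable-small V stable with count V ≤? α
    ... | yes p = p
    ... | no ≰α = ⊥-elim (<⇒≱ (survivors-many n Q (quota Q) x (ind≤-drop {suc α} {count A}
            (≤-trans (≰⇒> ≰α) (≤-reflexive (count-cong (λ i → sym (canon-≗ V i)))))
            (≤0 (canon≤wsum (λ A → stableLoss A x) V) stable≡0)))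
            (≤-trans (≤-reflexive (edges-stable n (survivors n x) A stable′)) z≤n))
      where
      A : Subset n
      A = canon V
      Q : Subset (n * n)
      Q = pairs (rect A A)
      stable′ : ∀ u v → A u ≡ true → A v ≡ true → adj G u v ≡ false
      stable′ u v p q = stable u v (trans (sym (canon-≗ V u)) p) (trans (sym (canon-≗ V v)) q)

    sparse : ∀ V W → count V ≤ α → count V ≤ count W → 1 ≤ count W → (∀ v → V v ≡ true → W v ≡ false) →
             ¬ (∀ v → W v ≡ true → t ≤ count (λ u → V u ∧ adj G v u))
    sparse V W V≤α V≤W 1≤W disj large = <⇒≱ few many
      where
      A B : Subset n
      A = canon V
      B = canon W
      V≡A : count V ≡ count A
      V≡A = count-cong (λ i → sym (canon-≗ V i))
      W≡B : count W ≡ count B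
      W≡B = count-cong (λ i → sym (canon-≗ W i))
      event : denseLoss A B x ≡ 0
      event = ≤0 (≤-trans (canon≤wsum (λ B → denseLoss A B x) W) (canon≤wsum (λ A → wsum 1 1 (λ B → denseLoss A B x)) V)) dense≡0
      guard : denseGuard A B ≡ 1
      guard = cong₂ _*_ (ind≤-yes (subst (_≤ α) V≡A V≤α))
                (cong₂ _*_ (ind≤-yes (subst (_≤ count B) V≡A (subst (count V ≤_) W≡B V≤W)))
                           (ind≤-yes (subst (1 ≤_) W≡B 1≤W)))
      few : edges (pairs (cross A B)) x < t * count B
      few = ind≤-zero {t * count B} (trans (sym (trans (cong (_* denseEvent A B x) guard) (*-identityˡ _))) event)
      many : t * count B ≤ edges (pairs (cross A B)) x
      many = edges-cross n x A B t
        (λ v h → trans (canon-≗ W v) (disj v (trans (sym (canon-≗ V v)) h)))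
        (λ v h → subst (t ≤_) (count-cong (λ i → cong (_∧ adj G v i) (sym (canon-≗ V i))))
                              (large v (trans (sym (canon-≗ W v)) h)))

    -- The smaller side has at most `α` vertices in either case: it is stable, or no larger than the
    -- stable side. The contradiction comes from the degrees on the larger side.
    no-dense-semiBipartite : ∀ (S : SemiBipartite G) → ¬ SBMinDeg S (t ≤_)
    no-dense-semiBipartite S minDeg with ≤-total (count (V₁ S)) (count (V₂ S))
    ... | inj₁ V₁≤V₂ = sparse (V₁ S) (V₂ S) (stable-small (V₁ S) (stable S)) V₁≤V₂ nonempty₂ (disjoint S) large
      where
      nonempty₂ : 1 ≤ count (V₂ S)
      nonempty₂ with nonempty S
      ... | v , h with ∨-split {V₁ S v} h
      ...   | inj₁ p = ≤-trans (member⇒count (V₁ S) v p) V₁≤V₂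
      ...   | inj₂ p = member⇒count (V₂ S) v p
      large : ∀ v → V₂ S v ≡ true → t ≤ count (λ u → V₁ S u ∧ adj G v u)
      large v h with V₁ S v in eq | minDeg v (∨-introʳ (V₁ S v) h)
      ... | true  | _ with () ← trans (sym (disjoint S v eq)) h
      ... | false | d = d
    ... | inj₂ V₂≤V₁ = sparse (V₂ S) (V₁ S) (≤-trans V₂≤V₁ (stable-small (V₁ S) (stable S))) V₂≤V₁ nonempty₁ disjoint′ large
      where
      nonempty₁ : 1 ≤ count (V₁ S)
      nonempty₁ with nonempty S
      ... | v , h with ∨-split {V₁ S v} h
      ...   | inj₁ p = member⇒count (V₁ S) v p
      ...   | inj₂ p = ≤-trans (member⇒count (V₂ S) v p) V₂≤V₁
      disjoint′ : ∀ v → V₂ S v ≡ true → V₁ S v ≡ false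
      disjoint′ v h with V₁ S v in eq
      ... | false = refl
      ... | true  = trans (sym h) (disjoint S v eq)
      large : ∀ v → V₁ S v ≡ true → t ≤ count (λ u → V₂ S u ∧ adj G v u)
      large v h with V₁ S v | h | minDeg v (cong (_∨ V₂ S v) h)
      ... | true | _ | d = d

-- Choice of parameters

ceil-sqrt : ∀ n → 1 ≤ n → ∃ λ R → n ≤ R * R × R * R ≤ 4 * n × 1 ≤ R
ceil-sqrt (suc zero) _ = 1 , s≤s z≤n , s≤s z≤n , s≤s z≤n
ceil-sqrt (suc n@(suc _)) _ with ceil-sqrt n (s≤s z≤n)
... | R , n≤R² , R²≤4n , 1≤R with suc n ≤? R * R
...   | yes p = R , p , ≤-trans R²≤4n (*-monoʳ-≤ 4 (n≤1+n n)) , 1≤R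
...   | no ¬p = suc R , lower , upper , s≤s z≤n
  where
  square : ∀ R → 1 + R * R + 2 * R ≡ (1 + R) * (1 + R)
  square = solve-∀
  double : ∀ R → (R + R) * (R + R) ≡ 4 * (R * R)
  double = solve-∀
  lower : suc n ≤ suc R * suc R
  lower = ≤-trans (s≤s n≤R²) (≤-trans (m≤m+n _ (2 * R)) (≤-reflexive (square R)))
  upper : suc R * suc R ≤ 4 * suc n
  upper = begin
    suc R * suc R        ≤⟨ *-mono-≤ (+-monoˡ-≤ R 1≤R) (+-monoˡ-≤ R 1≤R) ⟩
    (R + R) * (R + R)    ≡⟨ double R ⟩
    4 * (R * R)          ≤⟨ *-monoʳ-≤ 4 (<⇒≤ (≰⇒> ¬p)) ⟩
    4 * suc n            ∎

ceil-log : ∀ R → 1 ≤ R → ∃ λ l → R ≤ 2 ^ l × 2 ^ l ≤ 2 * R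
ceil-log (suc zero) _ = 0 , s≤s z≤n , s≤s z≤n
ceil-log (suc R@(suc _)) _ with ceil-log R (s≤s z≤n)
... | l , R≤2^l , 2^l≤2R with suc R ≤? 2 ^ l
...   | yes p = l , p , ≤-trans 2^l≤2R (*-monoʳ-≤ 2 (n≤1+n R))
...   | no ¬p = suc l , lower , *-monoʳ-≤ 2 (<⇒≤ (≰⇒> ¬p))
  where
  lower : suc R ≤ 2 * 2 ^ l
  lower = +-mono-≤ (m^n>0 2 l) (≤-trans R≤2^l (≤-reflexive (sym (+-identityʳ (2 ^ l)))))

-- As 4 · 32 · 128 = 2^14, the base case is 47 ≤ 2^6; the offset 19 would fail.
linear≤exponential : ∀ k → 4 * 32 * 128 * (2 * (k + 20) + 7) ≤ 2 ^ (k + 20)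
linear≤exponential zero    = ≤ᵇ⇒≤ (4 * 32 * 128 * 47) (2 ^ 20) _
linear≤exponential (suc k) = begin
  4 * 32 * 128 * (2 * (1 + k + 20) + 7)                     ≤⟨ m≤m+n _ (4 * 32 * 128 * (2 * k + 45)) ⟩
  4 * 32 * 128 * (2 * (1 + k + 20) + 7) + 4 * 32 * 128 * (2 * k + 45) ≡⟨ lemma (4 * 32 * 128) k ⟩
  2 * (4 * 32 * 128 * (2 * (k + 20) + 7))                   ≤⟨ *-monoʳ-≤ 2 (linear≤exponential k) ⟩
  2 ^ (1 + k + 20)                                   ∎
  where
  lemma : ∀ c k → c * (2 * (1 + k + 20) + 7) + c * (2 * k + 45) ≡ 2 * (c * (2 * (k + 20) + 7))
  lemma = solve-∀

square-cancel-≤ : ∀ {a b} → a * a ≤ b * b → a ≤ b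
square-cancel-≤ h = ≮⇒≥ (λ b<a → <⇒≱ (*-mono-< b<a b<a) h)

module Parameters (n : ℕ) (n-large : 2 ^ 21 * 2 ^ 21 ≤ n) where

  1≤n : 1 ≤ n
  1≤n = ≤-trans (*-mono-≤ (m^n>0 2 21) (m^n>0 2 21)) n-large

  instance
    n≢0 : NonZero n
    n≢0 = >-nonZero 1≤n

  R l L ρ : ℕ
  R = proj₁ (ceil-sqrt n 1≤n)
  n≤R² : n ≤ R * R
  n≤R² = proj₁ (proj₂ (ceil-sqrt n 1≤n))
  R²≤4n : R * R ≤ 4 * n
  R²≤4n = proj₁ (proj₂ (proj₂ (ceil-sqrt n 1≤n)))
  1≤R : 1 ≤ R
  1≤R = proj₂ (proj₂ (proj₂ (ceil-sqrt n 1≤n)))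
  l = proj₁ (ceil-log R 1≤R)
  R≤2^l : R ≤ 2 ^ l
  R≤2^l = proj₁ (proj₂ (ceil-log R 1≤R))
  2^l≤2R : 2 ^ l ≤ 2 * R
  2^l≤2R = proj₂ (proj₂ (ceil-log R 1≤R))
  -- This puts `2 ^ L` between n and 16n.
  L = 2 * l
  -- 128 is the least power of two whose square is at least 12288; it also makes σ even.
  ρ = pred (128 * R)

  σ≡128R : suc ρ ≡ 128 * R
  σ≡128R = suc-pred (128 * R) {{m*n≢0 128 R {{_}} {{>-nonZero 1≤R}}}}

  21≤l : 21 ≤ l
  21≤l = ≮⇒≥ (λ l<21 → <⇒≱ (^-monoʳ-< 2 (s≤s (s≤s z≤n)) l<21)
                            (≤-trans (square-cancel-≤ {2 ^ 21} (≤-trans n-large n≤R²)) R≤2^l))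

  2^L≡ : 2 ^ L ≡ 2 ^ l * 2 ^ l
  2^L≡ = trans (^-distribˡ-+-* 2 l (l + 0)) (cong (λ k → 2 ^ l * 2 ^ k) (+-identityʳ l))

  σ≡2u : suc ρ ≡ 2 * (64 * R)
  σ≡2u = trans σ≡128R (*-assoc 2 64 R)

  12288n≤σ² : 12288 * n ≤ suc ρ * suc ρ
  12288n≤σ² = begin
    12288 * n                      ≤⟨ *-monoʳ-≤ 12288 n≤R² ⟩
    12288 * (R * R)                ≤⟨ *-monoˡ-≤ (R * R) (≤ᵇ⇒≤ 12288 (128 * 128) _) ⟩
    128 * 128 * (R * R)            ≡⟨ lemma 128 R ⟩
    128 * R * (128 * R)            ≡⟨ cong₂ _*_ σ≡128R σ≡128R ⟨
    suc ρ * suc ρ                  ∎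
    where
    lemma : ∀ c R → c * c * (R * R) ≡ c * R * (c * R)
    lemma = solve-∀

  n≤2^L : n ≤ 2 ^ L
  n≤2^L = ≤-trans n≤R² (≤-trans (*-mono-≤ R≤2^l R≤2^l) (≤-reflexive (sym 2^L≡)))

  2^L≤n² : 2 ^ L ≤ n ^ 2
  2^L≤n² = begin
    2 ^ L                  ≡⟨ 2^L≡ ⟩
    2 ^ l * 2 ^ l          ≤⟨ *-mono-≤ 2^l≤2R 2^l≤2R ⟩
    2 * R * (2 * R)        ≡⟨ lemma R ⟩
    4 * (R * R)            ≤⟨ *-monoʳ-≤ 4 R²≤4n ⟩
    4 * (4 * n)            ≡⟨ *-assoc 4 4 n ⟨
    16 * n                 ≤⟨ *-monoˡ-≤ n (≤-trans (≤ᵇ⇒≤ 16 (2 ^ 21 * 2 ^ 21) _) n-large) ⟩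
    n * n                  ≡⟨ cong (n *_) (*-identityʳ n) ⟨
    n ^ 2                  ∎
    where
    lemma : ∀ R → 2 * R * (2 * R) ≡ 4 * (R * R)
    lemma = solve-∀

  -- The exponential estimate is used at l - 1, because `2 ^ l` may be as large as 2R; this is why l
  -- ≥ 21 and n ≥ 2^42 are required.
  R-large : 4 * 32 * 128 * (L + 5) ≤ R
  R-large = *-cancelˡ-≤ 2 (begin
    2 * (4 * 32 * 128 * (L + 5))                  ≡⟨ cong (λ L → 2 * (4 * 32 * 128 * (L + 5))) 2[k+21]≡L ⟨
    2 * (4 * 32 * 128 * (2 * (1 + k + 20) + 5))   ≡⟨ lemma (4 * 32 * 128) k ⟩
    2 * (4 * 32 * 128 * (2 * (k + 20) + 7))       ≤⟨ *-monoʳ-≤ 2 (linear≤exponential k) ⟩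
    2 ^ (1 + k + 20)                       ≡⟨ cong (2 ^_) k+21≡l ⟩
    2 ^ l                                  ≤⟨ 2^l≤2R ⟩
    2 * R                                  ∎)
    where
    k : ℕ
    k = l ∸ 21
    k+21≡l : 1 + k + 20 ≡ l
    k+21≡l = trans (sym (+-suc k 20)) (m∸n+n≡m 21≤l)
    2[k+21]≡L : 2 * (1 + k + 20) ≡ L
    2[k+21]≡L = cong (2 *_) k+21≡l
    lemma : ∀ c k → 2 * (c * (2 * (1 + k + 20) + 5)) ≡ 2 * (c * (2 * (k + 20) + 7))
    lemma = solve-∀

  star-large : 32 * suc ρ * (L + 4) + 1 ≤ n
  star-large = *-cancelˡ-≤ 4 (begin
    4 * (32 * suc ρ * (L + 4) + 1)             ≡⟨ cong (λ s → 4 * (32 * s * (L + 4) + 1)) σ≡128R ⟩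
    4 * (32 * (128 * R) * (L + 4) + 1)         ≤⟨ *-monoʳ-≤ 4 (+-monoʳ-≤ (32 * (128 * R) * (L + 4)) (≤-trans 1≤R (m≤n*m R (32 * 128)))) ⟩
    4 * (32 * (128 * R) * (L + 4) + 32 * 128 * R)  ≡⟨ lemma 32 128 R L ⟩
    R * (4 * 32 * 128 * (L + 5))                      ≤⟨ *-monoʳ-≤ R R-large ⟩
    R * R                                      ≤⟨ R²≤4n ⟩
    4 * n                                      ∎)
    where
    lemma : ∀ a b R L → 4 * (a * (b * R) * (L + 4) + a * b * R) ≡ R * (4 * a * b * (L + 5))
    lemma = solve-∀

  open RandomGraph ρ (64 * R) n L σ≡2u 12288n≤σ² n≤2^L star-large public

  -- Squaring brings in R² ≤ 4n, after which one factor n cancels; the 4 becomes the 2 inside the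
  -- square.
  degree-bound : ∀ d → n ≤ 32 * suc ρ * d → n ≤ (2 * (32 * 128) * d) * (2 * (32 * 128) * d)
  degree-bound d h = *-cancelˡ-≤ n (begin
    n * n                                    ≤⟨ *-mono-≤ h h ⟩
    32 * suc ρ * d * (32 * suc ρ * d)        ≡⟨ cong (λ s → 32 * s * d * (32 * s * d)) σ≡128R ⟩
    32 * (128 * R) * d * (32 * (128 * R) * d) ≡⟨ lemma₁ 32 128 R d ⟩
    R * R * (32 * 128 * d * (32 * 128 * d))          ≤⟨ *-monoˡ-≤ (32 * 128 * d * (32 * 128 * d)) R²≤4n ⟩
    4 * n * (32 * 128 * d * (32 * 128 * d))          ≡⟨ lemma₂ (32 * 128) n d ⟩
    n * ((2 * (32 * 128) * d) * (2 * (32 * 128) * d))            ∎)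
    where
    lemma₁ : ∀ a b R d → a * (b * R) * d * (a * (b * R) * d) ≡ R * R * (a * b * d * (a * b * d))
    lemma₁ = solve-∀
    lemma₂ : ∀ c n d → 4 * n * (c * d * (c * d)) ≡ n * ((2 * c * d) * (2 * c * d))
    lemma₂ = solve-∀

  -- Since L ≥ 6, `t` ≤ 135 · 2L = 270L, and `2 ^ L` ≤ n² turns this into 2^t ≤ n^540.
  t-bound : ∀ d → n ^ (2 * 270) ≤ 2 ^ d → t ≤ d
  t-bound d h = ≮⇒≥ (λ d<t → <⇒≱ (^-monoʳ-< 2 (s≤s (s≤s z≤n)) d<t) (begin
    2 ^ t                 ≤⟨ ^-monoʳ-≤ 2 exponent ⟩
    2 ^ (L * 270)         ≡⟨ ^-*-assoc 2 L 270 ⟨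
    (2 ^ L) ^ 270         ≤⟨ ^-monoˡ-≤ 270 2^L≤n² ⟩
    (n ^ 2) ^ 270         ≡⟨ ^-*-assoc n 2 270 ⟩
    n ^ (2 * 270)               ≤⟨ h ⟩
    2 ^ d                 ∎))
    where
    lemma : ∀ L → 135 * (L + L) ≡ L * 270
    lemma = solve-∀
    6≤L : 6 ≤ L
    6≤L = ≤-trans (≤ᵇ⇒≤ 6 21 _) (≤-trans 21≤l (m≤m+n l (l + 0)))
    exponent : t ≤ L * 270
    exponent = ≤-trans (*-monoʳ-≤ 135 (+-monoʳ-≤ L 6≤L)) (≤-reflexive (lemma L))

-- Real constants are avoided: the degree condition says deg ≥ √n / k, so δ = 1/k, and
-- `n ^ c ≤ 2 ^ d` says d ≥ (c / log 2) log n, so γ = c / log 2.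
theorem3p2 : ∃ λ (k : ℕ) → ∃ λ (c : ℕ) → 1 ≤ k × 1 ≤ c ×
    ∃ λ (N : ℕ) → ∀ (n : ℕ) → N ≤ n →
    Σ (Graph n) λ G →
    TriangleFree G
    × (∀ v → n ≤ (k * deg G v) * (k * deg G v))
    × ¬ (Σ (SemiBipartite G) λ S → SBMinDeg S (λ d → n ^ c ≤ 2 ^ d))
theorem3p2 = 2 * (32 * 128) , 2 * 270 , s≤s z≤n , s≤s z≤n , 2 ^ 21 * 2 ^ 21 , construct
  where
  construct : ∀ n → 2 ^ 21 * 2 ^ 21 ≤ n → Σ (Graph n) λ G →
              TriangleFree G
              × (∀ v → n ≤ (2 * (32 * 128) * deg G v) * (2 * (32 * 128) * deg G v))
              × ¬ (Σ (SemiBipartite G) λ S → SBMinDeg S (λ d → n ^ (2 * 270) ≤ 2 ^ d))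
  construct n n-large =
    G , survivorGraph-triangleFree n x , (λ v → degree-bound (deg G v) (degree v)) ,
    λ (S , minDeg) → no-dense-semiBipartite S (λ v v∈S → t-bound (sbDeg S v) (minDeg v v∈S))
    where
    open Parameters n n-large
    x : Subset (n * n)
    x = proj₁ lossless
    open Lossless x (proj₂ lossless)
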